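{- Let $G$ be a factorizable graph and let $X\subseteq V(G)$ be an odd-maximal barrier of $G$. Then $X$ is a disjoint union of some members of $\mathcal{P}(G)$; that is, there exist $S_1,\ldots,S_k\in\mathcal{P}(G)$ such that $X=S_1\,\dot\cup\,\cdots\,\dot\cup\, S_k$. Moreover, the vertex set $D_X$ of the odd components of $G-X$ satisfies $$D_X=\bigl(U^*(G_1)\setminus U^*(S_1)\bigr)\,\dot\cup\,\cdots\,\dot\cup\,\bigl(U^*(G_k)\setminus U^*(S_k)\bigr),$$ where, for each $i\in\{1,\ldots,k\}$, $G_i\in\mathcal{G}(G)$ is the factor-component with $S_i\in\mathcal{P}_G(G_i)$.
   Context: All graphs are finite. A matching is a set of pairwise disjoint edges; it is perfect if it covers all vertices. A graph is factorizable if it has a perfect matching, and factor-critical if deleting any single vertex yields the empty graph or a factorizable graph. For $X\subseteq V(G)$, $G[X]$ is the induced subgraph, $G-X=G[V(G)\setminus X]$, $G/X$ is the graph obtained by contracting $X$ into a single vertex, $\Gamma(X)$ is the set of vertices outside $X$ adjacent to some vertex of $X$. Let $G$ be factorizable. An edge is allowed if it lies in some perfect matching. For each connected component $C$ of the subgraph formed by the allowed edges, $G[V(C)]$ is a factor-component; $\mathcal{G}(G)$ is the set of factor-components. A set $X\subseteq V(G)$ is separating if every $H\in\mathcal{G}(G)$ has $V(H)\subseteq X$ or $V(H)\cap X=\emptyset$. Barriers: $q_G(X)$ is the number of odd components (components with an odd number of vertices) of $G-X$, $\nu(G)$ is the maximum matching size; $X$ is a barrier if $q_G(X)-|X|=|V(G)|-2\nu(G)$.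 $D_X$ denotes the set of vertices of the odd components of $G-X$ and $C_X=V(G)\setminus X\setminus D_X$. A barrier $X$ is odd-maximal if there is no nonempty $Y\subseteq D_X$ with $X\cup Y$ a barrier. Cathedral structure: for $G_1,G_2\in\mathcal{G}(G)$, write $G_1\trianglelefteq G_2$ if there is a separating set $X\supseteq V(G_1)\cup V(G_2)$ with $G[X]/V(G_1)$ factor-critical (this is a partial order on $\mathcal{G}(G)$). For $u,v\in V(G)$, $u\sim_G v$ if $u,v$ lie in the same factor-component and $G-u-v$ is not factorizable; this is an equivalence relation, and $\mathcal{P}(G)$ is its set of equivalence classes (the generalized canonical partition). For $H\in\mathcal{G}(G)$, $\mathcal{P}_G(H)=\{S\in\mathcal{P}(G):S\subseteq V(H)\}$ (a partition of $V(H)$). Let $\mathcal{U}^*(H)=\{H'\in\mathcal{G}(G):H\trianglelefteq H'\}$, $U^*(H)=\bigcup_{H'\in\mathcal{U}^*(H)}V(H')$, $U(H)=U^*(H)\setminus V(H)$. For $S\in\mathcal{P}_G(H)$, $\mathcal{U}(S)$ is the set of $H'\in\mathcal{G}(G)$ with $H\trianglelefteq H'$, $H'\neq H$, such that there is a connected component $K$ of $G[U(H)]$ with $\Gamma(K)\cap V(H)\subseteq S$ and $V(H')\subseteq V(K)$; $U(S)=\bigcup_{H'\in\mathcal{U}(S)}V(H')$ and $U^*(S)=U(S)\cup S$. -}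

module Defs where

open import Level using (Level; 0ℓ) renaming (suc to lsuc)
open import Data.Nat using (ℕ; suc; _*_; _≤_)
open import Data.Integer using (ℤ; +_; _-_)
open import Data.Fin using (Fin) renaming (_≤_ to _≤ᶠ_)
import Data.Fin.Subset as Sub
open import Data.Maybe using (Maybe; just; nothing)
open import Data.Product using (Σ; ∃; _×_; _,_; ∃-syntax; Σ-syntax)
open import Data.Sum using (_⊎_)
open import Data.Empty using (⊥)
open import Data.Unit using (⊤)
open import Relation.Nullary using (¬_; Dec)
open import Relation.Unary using (Pred; _∈_; _∉_; _⊆_; _≐_; _∪_; ∁)
open import Relation.Binary.PropositionalEquality using (_≡_; _≢_)

Disjoint : ∀ {V : Set} {ℓ₁ ℓ₂} → Pred V ℓ₁ → Pred V ℓ₂ → Set _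
Disjoint A B = ∀ v → A v → B v → ⊥

-- Generic notions for a graph given by an adjacency relation E on a
-- vertex type V, restricted to a vertex set S (i.e. the induced
-- subgraph G[S]).

module _ {V : Set} (E : V → V → Set) where

  -- m restricted to S is a perfect matching of G[S]: the matching edges
  -- are the pairs {v , m v} (v ∈ S); m is a fixed-point-free involution
  -- on S along edges of G[S].
  IsPerfectMatchingOn : ∀ {ℓ} → Pred V ℓ → (V → V) → Set ℓ
  IsPerfectMatchingOn S m =
    ∀ v → v ∈ S → (m v ∈ S) × E v (m v) × (m v ≢ v) × (m (m v) ≡ v)

  -- G[S] is factorizable (has a perfect matching); the empty graph is.
  Factorizable : ∀ {ℓ} → Pred V ℓ → Set ℓ
  Factorizable S = Σ (V → V) (IsPerfectMatchingOn S)

  _without_ : ∀ {ℓ} → Pred V ℓ → V → Pred V ℓ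
  (S without v) w = S w × w ≢ v

  FactorCritical : ∀ {ℓ} → Pred V ℓ → Set ℓ
  FactorCritical S = ∀ v → v ∈ S → Factorizable (S without v)

  data Reach {ℓ} (S : Pred V ℓ) : V → V → Set ℓ where
    here : ∀ {u} → u ∈ S → Reach S u u
    step : ∀ {u w v} → u ∈ S → E u w → Reach S w v → Reach S u v


-- Contraction G[X]/Y (Y ⊆ X): vertex type Maybe V, where nothing is the
-- new vertex obtained by contracting Y and just v (v ∈ X ∖ Y) are the
-- remaining vertices.  Loops are dropped, parallel edges merged.

module _ {V : Set} (E : V → V → Set) where

  ContrE : Pred V 0ℓ → Maybe V → Maybe V → Set
  ContrE Y nothing  nothing  = ⊥
  ContrE Y nothing  (just v) = ∃[ y ] (Y y × E y v)
  ContrE Y (just u) nothing  = ∃[ y ] (Y y × E u y)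
  ContrE Y (just u) (just v) = E u v

  ContrV : Pred V 0ℓ → Pred V 0ℓ → Pred (Maybe V) 0ℓ
  ContrV X Y nothing  = ⊤
  ContrV X Y (just v) = X v × ¬ Y v

record Graph : Set₁ where
  field
    n     : ℕ
    E     : Fin n → Fin n → Set
    E-dec : ∀ u v → Dec (E u v)
    E-sym : ∀ {u v} → E u v → E v u
    E-irr : ∀ {v} → ¬ E v v

Odd : ℕ → Set
Odd m = ∃[ j ] (m ≡ suc (2 * j))

module GraphNotions (G : Graph) where
  open Graph G public

  VSet : Set₁
  VSet = Pred (Fin n) 0ℓ

  All : VSet
  All _ = ⊤

  HasSize : ∀ {ℓ} → Pred (Fin n) ℓ → ℕ → Set ℓ
  HasSize P k = Σ[ s ∈ Sub.Subset n ] ((∀ v → (v Sub.∈ s → P v) × (P v → v Sub.∈ s)) × Sub.∣ s ∣ ≡ k)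

  -- a matching of G, given by its covered vertex set W and partner map m
  IsMatching : VSet → (Fin n → Fin n) → Set
  IsMatching W m = IsPerfectMatchingOn E W m

  MaxMatchingSize : ℕ → Set₁
  MaxMatchingSize k =
    (Σ[ W ∈ VSet ] Σ[ m ∈ (Fin n → Fin n) ] (IsMatching W m × HasSize W (2 * k)))
    × (∀ (W : VSet) m j → IsMatching W m → HasSize W (2 * j) → j ≤ k)

  D : VSet → VSet
  D X v = v ∉ X × ∃[ m ] (HasSize (Reach E (∁ X) v) m × Odd m)

  -- q_G(X) = k : each odd component counted once, via its least vertex
  OddCompCount : VSet → ℕ → Set
  OddCompCount X k = HasSize (λ v → D X v × (∀ w → Reach E (∁ X) v w → v ≤ᶠ w)) k

  Barrier : VSet → Set₁
  Barrier X = Σ[ ν ∈ ℕ ] Σ[ q ∈ ℕ ] Σ[ x ∈ ℕ ]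
    (MaxMatchingSize ν × OddCompCount X q × HasSize X x
     × (+ q - + x ≡ + n - + (2 * ν)))

  OddMaximalBarrier : VSet → Set₁
  OddMaximalBarrier X =
    Barrier X × ¬ (Σ[ Y ∈ VSet ] ((∃[ v ] Y v) × Y ⊆ D X × Barrier (X ∪ Y)))

  GFactorizable : Set
  GFactorizable = Factorizable E All

  Allowed : Fin n → Fin n → Set
  Allowed u v = E u v × Σ[ m ∈ (Fin n → Fin n) ] (IsPerfectMatchingOn E All m × m u ≡ v)

  data AReach : Fin n → Fin n → Set where
    here : ∀ {u} → AReach u u
    step : ∀ {u w v} → Allowed u w → AReach w v → AReach u v

  -- H ∈ 𝒢(G) (a factor-component, identified with its vertex set)
  IsFactorComponent : VSet → Set
  IsFactorComponent H = ∃[ r ] (H ≐ AReach r)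

  Separating : VSet → Set₁
  Separating X = ∀ (H : VSet) → IsFactorComponent H → H ⊆ X ⊎ Disjoint H X

  _⊴_ : VSet → VSet → Set₁
  G₁ ⊴ G₂ = Σ[ X ∈ VSet ]
    (Separating X × G₁ ⊆ X × G₂ ⊆ X × FactorCritical (ContrE E G₁) (ContrV E X G₁))

  _∼_ : Fin n → Fin n → Set
  u ∼ v = AReach u v × ¬ Factorizable E (λ w → w ≢ u × w ≢ v)

  InP : VSet → Set
  InP S = ∃[ u ] (S ≐ (u ∼_))

  Ustar : VSet → Pred (Fin n) (lsuc 0ℓ)
  Ustar H v = Σ[ H' ∈ VSet ] (IsFactorComponent H' × H ⊴ H' × H' v)

  Uminus : VSet → Pred (Fin n) (lsuc 0ℓ)
  Uminus H v = Ustar H v × ¬ H v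

  InUS : VSet → VSet → VSet → Set₁
  InUS H S H' =
    IsFactorComponent H' × H ⊴ H' × ¬ (H' ≐ H)
    × Σ[ k ∈ Fin n ] (Uminus H k
       -- K = the component of G[U(H)] containing k
       × (∀ w → H w → ¬ Reach E (Uminus H) k w
            → (∃[ k' ] (Reach E (Uminus H) k k' × E k' w)) → S w)   -- Γ(K) ∩ V(H) ⊆ S
       × H' ⊆ Reach E (Uminus H) k)

  US : VSet → VSet → Pred (Fin n) (lsuc 0ℓ)
  US H S v = Σ[ H' ∈ VSet ] (InUS H S H' × H' v)

  UstarS : VSet → VSet → Pred (Fin n) (lsuc 0ℓ)
  UstarS H S = US H S ∪ S

{-# OPTIONS --safe #-}

-- Fix a perfect matching m.  A set X is a barrier iff m sends its elements to
-- pairwise different components of G − X; the odd components are then the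
-- components K x of m x, for x ∈ X.  If X is odd-maximal every K x is
-- factor-critical: otherwise an essential vertex of K x and the Tutte–Berge
-- theorem (via Gallai's lemma) enlarge X inside D X.
--
-- Let x ⟶ y when y ∈ X has a neighbour in K x.  A Hall-type count shows that
-- every allowed edge at X lies inside a strongly connected component of ⟶, and
-- rotating matchings along paths of ⟶ gives the converse, so these components
-- are the traces on X of the factor-components, and each trace is a ∼-class.
-- For u ∈ X with factor-component H, the part of D X belonging to H is the
-- union of the K y with y ∈ X ∩ H.  It lies in U*(H) because contracting H in
-- its union with X ∩ H leaves a factor-critical graph, and it misses U*(S)
-- because each K y is connected to H outside X.  A vertex of U*(H) outside
-- this part and not in U(S) would produce a ∈ X ∩ U(H) with y ⟶ a for some
-- y ∈ X ∩ H, while the Hall count gives a path of ⟶ from a back to X ∩ H.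
module Submission where

open import Defs
open import Data.Nat using (ℕ)
open import Data.Fin using (Fin)
open import Data.Product using (Σ; _×_; Σ-syntax)
open import Relation.Nullary using (¬_)
open import Relation.Unary using (_⊆_; _≐_; _∈_; _∉_; ⋃)
open import Relation.Binary.PropositionalEquality using (_≢_)

open import Level using (Level)
open import Data.Bool using (true; false)
open import Data.Nat using (zero; suc; _+_; _*_; _≤_; _<_; z≤n; s≤s; s≤s⁻¹)
import Data.Nat.Properties as ℕₚ
import Data.Integer as ℤ
import Data.Integer.Properties as ℤₚ
open import Data.Fin using (zero; suc; punchOut) renaming (_≤_ to _≤ᶠ_)
import Data.Fin.Properties as Finₚ
open import Data.Fin.Properties using (_≟_; any?; all?; injective⇒≤; punchOut-injective; suc-injective)
import Data.Fin.Subset as Sub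
open import Data.Fin.Subset using (Subset; inside; outside)
import Data.Fin.Subset.Properties as Subₚ
open import Data.List using (List; []; _∷_; allFin)
open import Data.List.Membership.Propositional using () renaming (_∈_ to _∈ₗ_)
open import Data.List.Membership.Propositional.Properties using (∈-allFin)
import Data.List.Relation.Unary.Any as Any
open import Data.Maybe using (Maybe; just; nothing)
open import Data.Maybe.Properties using (just-injective)
open import Data.Vec using ([]; _∷_; tabulate; here; there)
open import Data.Vec.Properties using (lookup∘tabulate; lookup⇒[]=; []=⇒lookup)
import Data.Vec.Functional as Fun
open import Data.Product using (∃; _,_; proj₁; proj₂; ∃-syntax)
open import Data.Sum using (_⊎_; inj₁; inj₂; [_,_]′)
open import Data.Empty using (⊥; ⊥-elim)
open import Data.Unit using (tt)
open import Function using (_∘_; id)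
open import Function.Definitions using (Injective)
open import Relation.Nullary using (Dec; yes; no; does; contradiction)
open import Relation.Nullary.Decidable using (map′; _×-dec_; _⊎-dec_; ¬?; decidable-stable; dec-true; _→-dec_)
open import Relation.Unary using (Pred; Decidable; _∪_; ∁)
open import Relation.Binary using () renaming (Decidable to Decidable₂)
open import Relation.Binary.Core using (Rel)
open import Relation.Binary.Construct.Closure.ReflexiveTransitive using (Star; ε; _◅_; _◅◅_)
open import Relation.Binary.PropositionalEquality using (_≡_; refl; sym; trans; cong; subst; _≗_)

private variable
  ℓ ℓ₁ ℓ₂ : Level

-- Decidable searches over finite types

least : ∀ {n} {P : Pred (Fin n) ℓ} → Decidable P → ∀ {v} → P v →
        ∃[ u ] (P u × ∀ w → P w → u ≤ᶠ w)
least {n = suc n} P? {v} pv with P? zero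
... | yes p₀ = zero , p₀ , λ _ _ → z≤n
least {n = suc n} P? {zero}  pv | no ¬p₀ = contradiction pv ¬p₀
least {n = suc n} P? {suc v} pv | no ¬p₀ with least (P? ∘ suc) pv
... | u , pu , min = suc u , pu , λ where
  zero    p → contradiction p ¬p₀
  (suc w) p → s≤s (min w p)

-- The search chooses the value at zero and recurses on the tail. A function rebuilt by consing
-- agrees with the original only pointwise, hence the assumption that `P` respects `≗`.
any-function? : ∀ {n} k {P : Pred (Fin k → Fin n) ℓ} →
                (∀ {f g} → f ≗ g → P f → P g) → Decidable P → Dec (∃ P)
any-function? zero resp P? =
  map′ (_ ,_) (λ (f , pf) → resp (λ ()) pf) (P? λ ())
any-function? (suc k) resp P? =
  map′ (λ (a , f , p) → a Fun.∷ f , p)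
       (λ (f , p) → f zero , f ∘ suc , resp (λ { zero → refl ; (suc i) → refl }) p)
       (any? λ a → any-function? k (λ e → resp λ { zero → refl ; (suc i) → e i })
                                   (λ f → P? (a Fun.∷ f)))

-- Floyd–Warshall: Via ws relates the ends of walks all of whose inner
-- vertices are in ws.
module _ {n} {R : Rel (Fin n) ℓ} where

  Via : List (Fin n) → Rel (Fin n) ℓ
  Via []       u v = R u v
  Via (w ∷ ws) u v = Via ws u v ⊎ (Via ws u w × Via ws w v)

  via? : Decidable₂ R → ∀ ws → Decidable₂ (Via ws)
  via? R? []       u v = R? u v
  via? R? (w ∷ ws) u v = via? R? ws u v ⊎-dec (via? R? ws u w ×-dec via? R? ws w v)

  via-trans : ∀ {ws u w v} → w ∈ₗ ws → Via ws u w → Via ws w v → Via ws u v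
  via-trans (Any.here refl) (inj₁ p)       (inj₁ q)       = inj₂ (p , q)
  via-trans (Any.here refl) (inj₁ p)       (inj₂ (_ , q)) = inj₂ (p , q)
  via-trans (Any.here refl) (inj₂ (p , _)) (inj₁ q)       = inj₂ (p , q)
  via-trans (Any.here refl) (inj₂ (p , _)) (inj₂ (_ , q)) = inj₂ (p , q)
  via-trans (Any.there i)   (inj₁ p)       (inj₁ q)       = inj₁ (via-trans i p q)
  via-trans (Any.there i)   (inj₁ p)       (inj₂ (q , r)) = inj₂ (via-trans i p q , r)
  via-trans (Any.there i)   (inj₂ (p , q)) (inj₁ r)       = inj₂ (p , via-trans i q r)
  -- Both walks visit `w`; the closed walk between these visits is cut out.
  via-trans (Any.there i)   (inj₂ (p , _)) (inj₂ (_ , r)) = inj₂ (p , r)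

  edge⇒via : ∀ ws {u v} → R u v → Via ws u v
  edge⇒via []       e = e
  edge⇒via (w ∷ ws) e = inj₁ (edge⇒via ws e)

  via⇒star : ∀ ws {u v} → Via ws u v → Star R u v
  via⇒star []       e              = e ◅ ε
  via⇒star (w ∷ ws) (inj₁ p)       = via⇒star ws p
  via⇒star (w ∷ ws) (inj₂ (p , q)) = via⇒star ws p ◅◅ via⇒star ws q

  star⇒via : ∀ {u v} → Star R u v → u ≡ v ⊎ Via (allFin n) u v
  star⇒via ε       = inj₁ refl
  star⇒via (e ◅ p) with star⇒via p
  ... | inj₁ refl = inj₂ (edge⇒via (allFin n) e)
  ... | inj₂ q    = inj₂ (via-trans (∈-allFin _) (edge⇒via (allFin n) e) q)

  star? : Decidable₂ R → Decidable₂ (Star R)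
  star? R? u v = map′ [ (λ { refl → ε }) , via⇒star (allFin n) ]′ star⇒via
                      ((u ≟ v) ⊎-dec via? R? (allFin n) u v)

-- Subsets, the pigeonhole principle and parity

subset-of : ∀ {n} {P : Pred (Fin n) ℓ} → Decidable P →
            Σ[ s ∈ Subset n ] (∀ v → (v Sub.∈ s → P v) × (P v → v Sub.∈ s))
subset-of {P = P} P? = s , λ v → sound v , complete v
  where
  s = tabulate (does ∘ P?)
  sound : ∀ v → v Sub.∈ s → P v
  sound v v∈s with P? v | trans (sym (lookup∘tabulate (does ∘ P?) v)) ([]=⇒lookup v∈s)
  ... | yes p | _  = p
  ... | no _  | ()
  complete : ∀ v → P v → v Sub.∈ s
  complete v p = lookup⇒[]= v s (trans (lookup∘tabulate (does ∘ P?) v) (dec-true (P? v) p))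

enumerate : ∀ {n} (s : Subset n) → Σ[ e ∈ (Fin Sub.∣ s ∣ → Fin n) ]
            (Injective _≡_ _≡_ e × (∀ i → e i Sub.∈ s) × (∀ v → v Sub.∈ s → ∃[ i ] e i ≡ v))
enumerate [] = (λ ()) , (λ { {()} }) , (λ ()) , λ _ ()
enumerate (outside ∷ s) with enumerate s
... | e , inj , into , onto =
  suc ∘ e , (λ { eq → inj (suc-injective eq) }) , there ∘ into ,
  λ { .(suc _) (there v∈s) → let i , eq = onto _ v∈s in i , cong suc eq }
enumerate {suc n} (inside ∷ s) with enumerate s
... | e , inj , into , onto = e⁺ , inj⁺ , into⁺ , onto⁺
  where
  e⁺ : Fin (suc Sub.∣ s ∣) → Fin (suc n)
  e⁺ zero    = zero
  e⁺ (suc i) = suc (e i)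
  inj⁺ : Injective _≡_ _≡_ e⁺
  inj⁺ {zero}  {zero}  _  = refl
  inj⁺ {suc i} {suc j} eq = cong suc (inj (suc-injective eq))
  into⁺ : ∀ i → e⁺ i Sub.∈ inside ∷ s
  into⁺ zero    = here
  into⁺ (suc i) = there (into i)
  onto⁺ : ∀ v → v Sub.∈ inside ∷ s → ∃[ i ] e⁺ i ≡ v
  onto⁺ _ here        = zero , refl
  onto⁺ _ (there v∈s) = let i , eq = onto _ v∈s in suc i , cong suc eq

injective⇒surjective : ∀ {a b} {f : Fin a → Fin b} → Injective _≡_ _≡_ f → b ≤ a →
                       ∀ j → ∃[ i ] f i ≡ j
injective⇒surjective {b = suc b} {f} inj b≤a j with any? (λ i → f i ≟ j)
... | yes p = p
... | no ¬p = contradiction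
  (injective⇒≤ {f = λ i → punchOut (j≢f i)} λ {i} {i'} eq → inj (punchOut-injective (j≢f i) (j≢f i') eq))
  (ℕₚ.<⇒≱ b≤a)
  where
  j≢f : ∀ i → j ≢ f i
  j≢f i eq = ¬p (i , sym eq)

Even : ℕ → Set
Even m = ∃[ j ] m ≡ 2 * j

even-suc-suc : ∀ {m} → Even m → Even (suc (suc m))
even-suc-suc (j , refl) = suc j , cong suc (sym (ℕₚ.+-suc j (j + 0)))

even-odd : ∀ {m} → Even m → ¬ Odd m
even-odd (i , refl) (j , eq) = lemma i j eq
  where
  lemma : ∀ i j → 2 * i ≢ suc (2 * j)
  lemma (suc i) zero    eq with trans (sym (ℕₚ.+-suc i (i + 0))) (ℕₚ.suc-injective eq)
  ... | ()
  lemma (suc i) (suc j) eq = lemma i j (ℕₚ.suc-injective (trans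
    (trans (sym (ℕₚ.+-suc i (i + 0))) (ℕₚ.suc-injective eq)) (cong suc (ℕₚ.+-suc j (j + 0)))))

even-≤ : ∀ {a b} → Even a → Even b → a ≤ suc b → a ≤ b
even-≤ {a} {b} ea (j , refl) a≤ with ℕₚ.m≤n⇒m<n∨m≡n a≤
... | inj₁ (s≤s a≤b) = a≤b
... | inj₂ refl      = contradiction (j , refl) (even-odd ea)

-- Finite cardinalities

module Counting (G : Graph) where
  open GraphNotions G

  _∖_ : Pred (Fin n) ℓ → Fin n → Pred (Fin n) ℓ
  P ∖ v = _without_ E P v
  infixl 6 _∖_

  ∖? : {P : Pred (Fin n) ℓ} → Decidable P → ∀ u → Decidable (P ∖ u)
  ∖? P? u v = P? v ×-dec ¬? (v ≟ u)

  abstract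
    sized : {P : Pred (Fin n) ℓ} → Decidable P → ∃ (HasSize P)
    sized P? = let s , spec = subset-of P? in Sub.∣ s ∣ , s , spec , refl

  sized⇒decidable : ∀ {P : Pred (Fin n) ℓ} {k} → HasSize P k → Decidable P
  sized⇒decidable (s , spec , _) v = map′ (proj₁ (spec v)) (proj₂ (spec v)) (v Subₚ.∈? s)

  size-resp : ∀ {P : Pred (Fin n) ℓ₁} {Q : Pred (Fin n) ℓ₂} {k} → P ⊆ Q → Q ⊆ P → HasSize P k → HasSize Q k
  size-resp p q (s , spec , eq) = s , (λ v → p ∘ proj₁ (spec v) , proj₂ (spec v) ∘ q) , eq

  size-≤n : ∀ {P : Pred (Fin n) ℓ} {k} → HasSize P k → k ≤ n
  size-≤n (s , _ , refl) = Subₚ.∣p∣≤n s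

  enumeration : ∀ {P : Pred (Fin n) ℓ} {k} → HasSize P k → Σ[ e ∈ (Fin k → Fin n) ]
                (Injective _≡_ _≡_ e × (∀ i → P (e i)) × (∀ {v} → P v → ∃[ i ] e i ≡ v))
  enumeration (s , spec , refl) with enumerate s
  ... | e , inj , into , onto =
    e , inj , (λ i → proj₁ (spec _) (into i)) , λ p → onto _ (proj₂ (spec _) p)

  module _ {P : Pred (Fin n) ℓ₁} {Q : Pred (Fin n) ℓ₂} {a b} (hP : HasSize P a) (hQ : HasSize Q b)
           (F : Fin n → Fin n → Set ℓ) (total : ∀ {v} → P v → ∃[ w ] (Q w × F v w))
           (injective : ∀ {v v' w} → P v → P v' → F v w → F v' w → v ≡ v') where
    private
      eP = enumeration hP
      eQ = enumeration hQ
      image : (i : Fin a) → ∃[ w ] (Q w × F (proj₁ eP i) w)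
      image i = total (proj₁ (proj₂ (proj₂ eP)) i)
      index : (i : Fin a) → ∃[ j ] proj₁ eQ j ≡ proj₁ (image i)
      index i = proj₂ (proj₂ (proj₂ eQ)) (proj₁ (proj₂ (image i)))
      index-injective : Injective _≡_ _≡_ (proj₁ ∘ index)
      index-injective {i} {i'} eq = proj₁ (proj₂ eP) (injective
        (proj₁ (proj₂ (proj₂ eP)) i) (proj₁ (proj₂ (proj₂ eP)) i')
        (proj₂ (proj₂ (image i)))
        (subst (F _) (trans (sym (proj₂ (index i'))) (trans (cong (proj₁ eQ) (sym eq)) (proj₂ (index i))))
               (proj₂ (proj₂ (image i')))))

    injection⇒≤ : a ≤ b
    injection⇒≤ = injective⇒≤ index-injective

    private
      hit : b ≤ a → ∀ {w} → Q w → ∃[ i ] proj₁ (image i) ≡ w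
      hit b≤a q with proj₂ (proj₂ (proj₂ eQ)) q
      ... | j , refl with injective⇒surjective index-injective b≤a j
      ... | i , refl = i , sym (proj₂ (index i))

    injection⇒onto : b ≤ a → ∀ {w} → Q w → ∃[ v ] (P v × F v w)
    injection⇒onto b≤a q with hit b≤a q
    ... | i , refl = _ , proj₁ (proj₂ (proj₂ eP)) i , proj₂ (proj₂ (image i))

    -- The images chosen by `total` exhaust `Q` when the sizes agree. So `w` and `w'` are both
    -- chosen images, and injectivity of `F` makes them the image of the same `v`.
    injection⇒functional : b ≤ a → ∀ {v w w'} → P v → Q w → Q w' → F v w → F v w' → w ≡ w'
    injection⇒functional b≤a p q q' f f' with hit b≤a q | hit b≤a q'
    ... | i , refl | i' , refl = cong (proj₁ ∘ image) (proj₁ (proj₂ eP) (trans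
      (injective (proj₁ (proj₂ (proj₂ eP)) i) p (proj₂ (proj₂ (image i))) f)
      (sym (injective (proj₁ (proj₂ (proj₂ eP)) i') p (proj₂ (proj₂ (image i'))) f'))))

  size-mono : ∀ {P : Pred (Fin n) ℓ₁} {Q : Pred (Fin n) ℓ₂} {a b} → HasSize P a → HasSize Q b → P ⊆ Q → a ≤ b
  size-mono hP hQ P⊆Q = injection⇒≤ hP hQ _≡_ (λ p → _ , P⊆Q p , refl) λ { _ _ refl refl → refl }

  size-antisym : ∀ {P : Pred (Fin n) ℓ₁} {Q : Pred (Fin n) ℓ₂} {a b} → HasSize P a → HasSize Q b →
                 b ≤ a → P ⊆ Q → Q ⊆ P
  size-antisym hP hQ b≤a P⊆Q q
    with injection⇒onto hP hQ _≡_ (λ p → _ , P⊆Q p , refl) (λ { _ _ refl refl → refl }) b≤a q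
  ... | _ , p , refl = p

  size-unique : ∀ {P : Pred (Fin n) ℓ} {a b} → HasSize P a → HasSize P b → a ≡ b
  size-unique h h' = ℕₚ.≤-antisym (size-mono h h' id) (size-mono h' h id)

  private
    subset-remove : ∀ {n} (s : Subset n) {v} → v Sub.∈ s →
      Σ[ t ∈ Subset n ] (Sub.∣ s ∣ ≡ suc Sub.∣ t ∣ ×
        (∀ w → (w Sub.∈ t → w Sub.∈ s × w ≢ v) × (w Sub.∈ s × w ≢ v → w Sub.∈ t)))
    subset-remove (inside ∷ s) here = outside ∷ s , refl , λ where
      zero    → (λ ()) , λ (_ , z≢z) → contradiction refl z≢z
      (suc w) → (λ { (there p) → there p , λ () }) , λ { (there p , _) → there p }
    subset-remove (x ∷ s) {suc v} (there v∈s) with subset-remove s v∈s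
    ... | t , eq , spec = x ∷ t , size-eq x , λ where
          zero    → (λ { here → here , λ () }) , λ { (here , _) → here }
          (suc w) → (λ { (there p) → let q , w≢v = proj₁ (spec w) p in
                            there q , λ { refl → w≢v refl } })
                  , λ { (there p , sw≢sv) → there (proj₂ (spec w) (p , sw≢sv ∘ cong suc)) }
      where
      size-eq : ∀ x → Sub.∣ x ∷ s ∣ ≡ suc Sub.∣ x ∷ t ∣
      size-eq true  = cong suc eq
      size-eq false = eq

  size-remove : ∀ {P : Pred (Fin n) ℓ} {k v} → HasSize P k → P v →
                ∃[ j ] (k ≡ suc j × HasSize (P ∖ v) j)
  size-remove {v = v} (s , spec , refl) pv with subset-remove s (proj₂ (spec v) pv)
  ... | t , eq , tspec = Sub.∣ t ∣ , eq , t , (λ w →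
    (λ w∈t → let w∈s , w≢v = proj₁ (tspec w) w∈t in proj₁ (spec w) w∈s , w≢v) ,
    λ (pw , w≢v) → proj₂ (tspec w) (proj₂ (spec w) pw , w≢v)) , refl

  record Involution (P : Pred (Fin n) ℓ) (m : Fin n → Fin n) : Set ℓ where
    field
      closed     : ∀ {v} → P v → P (m v)
      involutive : ∀ {v} → P v → m (m v) ≡ v
      no-fixed   : ∀ {v} → P v → m v ≢ v

  involution⇒even : ∀ {P : Pred (Fin n) ℓ} {m k} → HasSize P k → Involution P m → Even k
  involution⇒even {m = m} {k = k} h i = go k k ℕₚ.≤-refl h i
    where
    -- Each round removes the pair `v`, `m v`, so the size drops by two; `f` is fuel bounding it.
    go : ∀ {P : Pred (Fin n) ℓ} f k → k ≤ f → HasSize P k → Involution P m → Even k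
    go f zero _ _ _ = 0 , refl
    go {P = P} (suc f) (suc k) (s≤s k≤f) h i with enumeration h
    ... | e , _ , into , _ = conclude (size-remove h pv)
      where
      open Involution i
      v = e zero
      pv : P v
      pv = into zero
      conclude : ∃[ j ] (suc k ≡ suc j × HasSize (P ∖ v) j) → Even (suc k)
      conclude (j , refl , h₁) with size-remove h₁ (closed pv , no-fixed pv)
      ... | l , refl , h₂ = even-suc-suc (go f l (ℕₚ.≤-trans (ℕₚ.n≤1+n l) k≤f) h₂ (record
        { closed     = λ ((p , w≢v) , w≢mv) →
            (closed p , λ eq → w≢mv (trans (sym (involutive p)) (cong m eq)))
            , λ eq → w≢v (trans (sym (involutive p)) (trans (cong m eq) (involutive pv)))
        ; involutive = λ ((p , _) , _) → involutive p
        ; no-fixed   = λ ((p , _) , _) → no-fixed p }))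

  involution⇒odd : ∀ {P : Pred (Fin n) ℓ} {m k v} → HasSize P k → P v → Involution (P ∖ v) m → Odd k
  involution⇒odd h pv i with size-remove h pv
  ... | j , refl , h' with involution⇒even h' i
  ... | l , refl = l , refl

  -- A fixed-point-free involution pairs off any set that it preserves, and an odd set cannot be
  -- paired off.
  odd⇒leaves : ∀ {P : Pred (Fin n) ℓ} {m k} → HasSize P k → Odd k →
               (∀ {v} → P v → m (m v) ≡ v) → (∀ {v} → P v → m v ≢ v) → ∃[ v ] (P v × ¬ P (m v))
  odd⇒leaves {P = P} {m} h odd inv fp = decidable-stable
    (any? λ v → P? v ×-dec ¬? (P? (m v)))
    λ none → even-odd (involution⇒even {m = m} h (record
      { closed     = λ {v} p → decidable-stable (P? (m v)) λ ¬p → none (v , p , ¬p)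
      ; involutive = inv
      ; no-fixed   = fp })) odd
    where P? = sized⇒decidable h

-- Walks, matchings and alternating paths

module Matchings (G : Graph) where
  open GraphNotions G
  open Counting G

  -- Walks

  module _ {S : Pred (Fin n) ℓ} where

    reach-start : ∀ {u v} → Reach E S u v → S u
    reach-start (here s)     = s
    reach-start (step s _ _) = s

    reach-end : ∀ {u v} → Reach E S u v → S v
    reach-end (here s)     = s
    reach-end (step _ _ r) = reach-end r

    reach-trans : ∀ {u v w} → Reach E S u v → Reach E S v w → Reach E S u w
    reach-trans (here _)     q = q
    reach-trans (step s e p) q = step s e (reach-trans p q)

    reach-snoc : ∀ {u v w} → Reach E S u v → E v w → S w → Reach E S u w
    reach-snoc p e s = reach-trans p (step (reach-end p) e (here s))

    reach-sym : ∀ {u v} → Reach E S u v → Reach E S v u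
    reach-sym (here s)     = here s
    reach-sym (step s e p) = reach-snoc (reach-sym p) (E-sym e) s

    reach-invariant : ∀ {Q : Pred (Fin n) ℓ₁} → (∀ {a b} → Q a → E a b → S b → Q b) →
                      ∀ {u v} → Reach E S u v → Q u → Q v
    reach-invariant c (here _)     q = q
    reach-invariant c (step _ e p) q = reach-invariant c p (c q e (reach-start p))

    abstract
      reach? : Decidable S → ∀ u v → Dec (Reach E S u v)
      reach? S? u v = map′ (λ (s , p) → to s p) (λ p → reach-start p , from p)
        (S? u ×-dec star? (λ a b → E-dec a b ×-dec S? b) u v)
        where
        to : ∀ {u v} → S u → Star (λ a b → E a b × S b) u v → Reach E S u v
        to s ε              = here s
        to s ((e , s') ◅ p) = step s e (to s' p)
        from : ∀ {u v} → Reach E S u v → Star (λ a b → E a b × S b) u v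
        from (here _)     = ε
        from (step _ e p) = (e , reach-start p) ◅ from p

  reach-mono : ∀ {S : Pred (Fin n) ℓ₁} {T : Pred (Fin n) ℓ₂} → S ⊆ T → ∀ {u v} → Reach E S u v → Reach E T u v
  reach-mono f (here s)     = here (f s)
  reach-mono f (step s e p) = step (f s) e (reach-mono f p)

  pm-resp : ∀ {S : Pred (Fin n) ℓ} {f g} → f ≗ g → IsPerfectMatchingOn E S f → IsPerfectMatchingOn E S g
  pm-resp {S = S} {f} {g} eq p v s with p v s
  ... | c , e , nf , i = subst S (eq v) c , subst (E v) (eq v) e , (λ q → nf (trans (eq v) q)) ,
                         trans (sym (trans (eq (f v)) (cong g (eq v)))) i

  pm? : ∀ {S : Pred (Fin n) ℓ} → Decidable S → ∀ f → Dec (IsPerfectMatchingOn E S f)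
  pm? S? f = all? λ v → S? v →-dec
    (S? (f v) ×-dec E-dec v (f v) ×-dec ¬? (f v ≟ v) ×-dec (f (f v) ≟ v))

  abstract
    factorizable? : ∀ {S : Pred (Fin n) ℓ} → Decidable S → Dec (Factorizable E S)
    factorizable? S? = any-function? n pm-resp (pm? S?)

  factorizable-resp : ∀ {A : Pred (Fin n) ℓ₁} {B : Pred (Fin n) ℓ₂} → A ⊆ B → B ⊆ A → Factorizable E A → Factorizable E B
  factorizable-resp f g (m , p) = m , λ v b → let c , rest = p v (g b) in f c , rest

  pm-∪ : ∀ {A B : VSet} {f g} → Decidable A → (∀ {v} → A v → B v → ⊥) →
         IsPerfectMatchingOn E A f → IsPerfectMatchingOn E B g →
         Σ[ h ∈ (Fin n → Fin n) ] (IsPerfectMatchingOn E (A ∪ B) h × (∀ {v} → A v → h v ≡ f v))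
  pm-∪ {A} {B} {f} {g} A? disj p q = h , pm , h-A
    where
    h : Fin n → Fin n
    h v with A? v
    ... | yes _ = f v
    ... | no _  = g v
    h-A : ∀ {v} → A v → h v ≡ f v
    h-A {v} a with A? v
    ... | yes _ = refl
    ... | no ¬a = contradiction a ¬a
    h-B : ∀ {v} → B v → h v ≡ g v
    h-B {v} b with A? v
    ... | yes a = ⊥-elim (disj a b)
    ... | no _  = refl
    pm : IsPerfectMatchingOn E (A ∪ B) h
    pm v (inj₁ a) rewrite h-A a = let c , e , nf , i = p v a in
      inj₁ c , e , nf , trans (h-A c) i
    pm v (inj₂ b) rewrite h-B b = let c , e , nf , i = q v b in
      inj₂ c , e , nf , trans (h-B c) i

  factorizable-∪ : ∀ {A B : VSet} → Decidable A → (∀ {v} → A v → B v → ⊥) →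
                   Factorizable E A → Factorizable E B → Factorizable E (A ∪ B)
  factorizable-∪ A? disj (_ , p) (_ , q) = let h , r , _ = pm-∪ A? disj p q in h , r

  factorizable-edge : ∀ {a b} → E a b → Factorizable E (λ w → w ≡ a ⊎ w ≡ b)
  factorizable-edge {a} {b} e = swap , pm
    where
    a≢b : a ≢ b
    a≢b refl = E-irr e
    swap : Fin n → Fin n
    swap w with w ≟ a
    ... | yes _ = b
    ... | no _  = a
    swap-a : swap a ≡ b
    swap-a with a ≟ a
    ... | yes _  = refl
    ... | no a≢a = contradiction refl a≢a
    swap-b : swap b ≡ a
    swap-b with b ≟ a
    ... | yes b≡a = contradiction (sym b≡a) a≢b
    ... | no _    = refl
    pm : IsPerfectMatchingOn E (λ w → w ≡ a ⊎ w ≡ b) swap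
    pm _ (inj₁ refl) rewrite swap-a = inj₂ refl , e , a≢b ∘ sym , swap-b
    pm _ (inj₂ refl) rewrite swap-b = inj₁ refl , E-sym e , a≢b , swap-a

  -- Partial matchings, as involutions whose fixed points are the vertices
  -- left uncovered

  record Matching (S : VSet) (m : Fin n → Fin n) : Set where
    field
      involutive : ∀ v → m (m v) ≡ v
      edge       : ∀ {v} → m v ≢ v → S v × E v (m v)
    outside-fixed : ∀ {v} → ¬ S v → m v ≡ v
    outside-fixed {v} ¬s = decidable-stable (m v ≟ v) (¬s ∘ proj₁ ∘ edge)
    covered-closed : ∀ {v} → m v ≢ v → m (m v) ≢ m v
    covered-closed mv≢v eq = mv≢v (trans (sym eq) (involutive _))
  open Matching

  Covered : (Fin n → Fin n) → VSet
  Covered m v = m v ≢ v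

  covered? : ∀ m → Decidable (Covered m)
  covered? m v = ¬? (m v ≟ v)

  abstract
    -- Counting covered vertices instead of edges makes every size even, and an inserted edge adds
    -- 2.
    size : (Fin n → Fin n) → ℕ
    size m = proj₁ (sized (covered? m))

    hasSize-covered : ∀ m → HasSize (Covered m) (size m)
    hasSize-covered m = proj₂ (sized (covered? m))

  size-even : ∀ {S m} → Matching S m → Even (size m)
  size-even {m = m} M = involution⇒even (hasSize-covered m) (record
    { closed     = covered-closed M
    ; involutive = λ _ → involutive M _
    ; no-fixed   = id })

  matching-mono : ∀ {S T m} → S ⊆ T → Matching S m → Matching T m
  matching-mono f M = record
    { involutive = involutive M ; edge = λ c → let s , e = edge M c in f s , e }

  matching-∖ : ∀ {S m v} → Matching S m → m v ≡ v → Matching (S ∖ v) m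
  matching-∖ M fix = record
    { involutive = involutive M
    ; edge = λ c → let s , e = edge M c in (s , λ { refl → c fix }) , e }

  matching-resp : ∀ {S f g} → f ≗ g → Matching S f → Matching S g
  matching-resp {f = f} {g} eq M = record
    { involutive = λ v → trans (sym (trans (eq (f v)) (cong g (eq v)))) (involutive M v)
    ; edge = λ {v} c → let s , e = edge M (λ q → c (trans (sym (eq v)) q)) in s , subst (E v) (eq v) e }

  matching? : ∀ {S} → Decidable S → ∀ m → Dec (Matching S m)
  matching? S? m = map′
    (λ (i , e) → record { involutive = i ; edge = λ {v} → e v })
    (λ M → involutive M , λ v → edge M)
    (all? (λ v → m (m v) ≟ v) ×-dec all? (λ v → ¬? (m v ≟ v) →-dec (S? v ×-dec E-dec v (m v))))

  size-resp-≗ : ∀ {f g} → f ≗ g → size f ≡ size g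
  size-resp-≗ {f} {g} eq = size-unique
    (size-resp (λ {v} c q → c (trans (eq v) q)) (λ {v} c q → c (trans (sym (eq v)) q)) (hasSize-covered f))
    (hasSize-covered g)

  size-+2 : ∀ m m' {a b} → a ≢ b → m a ≡ a → m b ≡ b → m' a ≢ a → m' b ≢ b →
            (∀ {v} → v ≢ a → v ≢ b → m' v ≡ m v) → size m' ≡ 2 + size m
  size-+2 m m' {a} {b} a≢b fa fb ca cb agree
    with size m' | hasSize-covered m'
  ... | _ | h with size-remove h ca
  ... | _ , refl , h₁ with size-remove h₁ (cb , a≢b ∘ sym)
  ... | _ , refl , h₂ = cong (2 +_) (size-unique
    (size-resp {Q = Covered m}
               (λ ((c , v≢a) , v≢b) q → c (trans (agree v≢a v≢b) q))
               (λ {v} c → (let v≢a = λ { refl → c fa } ; v≢b = λ { refl → c fb } in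
                           ((λ q → c (trans (sym (agree v≢a v≢b)) q)) , v≢a) , v≢b))
               h₂)
    (hasSize-covered m))

  record Insertion (S : VSet) (m : Fin n → Fin n) (a b : Fin n) : Set where
    field
      m⁺       : Fin n → Fin n
      matching : Matching S m⁺
      at-a     : m⁺ a ≡ b
      at-b     : m⁺ b ≡ a
      agree    : ∀ {v} → v ≢ a → v ≢ b → m⁺ v ≡ m v
      bigger   : size m⁺ ≡ 2 + size m

  insert : ∀ {S m a b} → Matching S m → S a → S b → E a b → m a ≡ a → m b ≡ b → Insertion S m a b
  insert {S} {m} {a} {b} M sa sb e fa fb = record
    { m⁺ = m⁺ ; matching = record { involutive = inv ; edge = edge⁺ }
    ; at-a = at-a ; at-b = at-b ; agree = agree
    ; bigger = size-+2 m m⁺ a≢b fa fb (λ q → a≢b (trans (sym q) at-a)) (λ q → a≢b (trans (sym at-b) q)) agree }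
    where
    a≢b : a ≢ b
    a≢b refl = E-irr e
    m⁺ : Fin n → Fin n
    m⁺ v with v ≟ a | v ≟ b
    ... | yes _ | _     = b
    ... | no _  | yes _ = a
    ... | no _  | no _  = m v
    at-a : m⁺ a ≡ b
    at-a with a ≟ a | a ≟ b
    ... | yes _  | _ = refl
    ... | no a≢a | _ = contradiction refl a≢a
    at-b : m⁺ b ≡ a
    at-b with b ≟ a | b ≟ b
    ... | yes b≡a | _      = contradiction (sym b≡a) a≢b
    ... | no _    | yes _  = refl
    ... | no _    | no b≢b = contradiction refl b≢b
    agree : ∀ {v} → v ≢ a → v ≢ b → m⁺ v ≡ m v
    agree {v} v≢a v≢b with v ≟ a | v ≟ b
    ... | yes v≡a | _       = contradiction v≡a v≢a
    ... | no _    | yes v≡b = contradiction v≡b v≢b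
    ... | no _    | no _    = refl
    m-avoids : ∀ {v u} → m u ≡ u → v ≢ u → m v ≢ u
    m-avoids fu v≢u eq = v≢u (trans (sym (involutive M _)) (trans (cong m eq) fu))
    inv : ∀ v → m⁺ (m⁺ v) ≡ v
    inv v with v ≟ a | v ≟ b
    ... | yes refl | _        = at-b
    ... | no _     | yes refl = at-a
    ... | no v≢a   | no v≢b   = trans (agree (m-avoids fa v≢a) (m-avoids fb v≢b)) (involutive M v)
    edge⁺ : ∀ {v} → m⁺ v ≢ v → S v × E v (m⁺ v)
    edge⁺ {v} c with v ≟ a | v ≟ b
    ... | yes refl | _        = sa , e
    ... | no _     | yes refl = sb , E-sym e
    ... | no v≢a   | no v≢b   = edge M c

  record Deletion (S : VSet) (m : Fin n → Fin n) (t : Fin n) : Set where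
    field
      m⁻       : Fin n → Fin n
      matching : Matching (S ∖ t ∖ m t) m⁻
      at-t     : m⁻ t ≡ t
      at-mt    : m⁻ (m t) ≡ m t
      agree    : ∀ {v} → v ≢ t → v ≢ m t → m⁻ v ≡ m v
      smaller  : size m ≡ 2 + size m⁻

  delete : ∀ {S m t} → Matching S m → m t ≢ t → Deletion S m t
  delete {S} {m} {t} M mt≢t = record
    { m⁻ = m⁻ ; matching = matching-∖ (matching-∖ (record { involutive = inv ; edge = edge⁻ }) at-t) at-mt
    ; at-t = at-t ; at-mt = at-mt ; agree = agree
    ; smaller = size-+2 m⁻ m (mt≢t ∘ sym) at-t at-mt mt≢t (covered-closed M mt≢t) (λ p q → sym (agree p q)) }
    where
    m⁻ : Fin n → Fin n
    m⁻ v with v ≟ t | v ≟ m t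
    ... | no _ | no _ = m v
    ... | _    | _    = v
    at-t : m⁻ t ≡ t
    at-t with t ≟ t | t ≟ m t
    ... | yes _  | _ = refl
    ... | no t≢t | _ = contradiction refl t≢t
    at-mt : m⁻ (m t) ≡ m t
    at-mt with m t ≟ t | m t ≟ m t
    ... | yes _ | _     = refl
    ... | no _  | yes _ = refl
    ... | no _  | no ¬p = contradiction refl ¬p
    agree : ∀ {v} → v ≢ t → v ≢ m t → m⁻ v ≡ m v
    agree {v} v≢t v≢mt with v ≟ t | v ≟ m t
    ... | yes p | _     = contradiction p v≢t
    ... | no _  | yes p = contradiction p v≢mt
    ... | no _  | no _  = refl
    inv : ∀ v → m⁻ (m⁻ v) ≡ v
    inv v with v ≟ t | v ≟ m t
    ... | yes refl | _        = at-t
    ... | no _     | yes refl = at-mt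
    ... | no v≢t   | no v≢mt  =
      trans (agree (λ q → v≢mt (trans (sym (involutive M v)) (cong m q)))
                   (λ q → v≢t (trans (sym (involutive M v)) (trans (cong m q) (involutive M t)))))
            (involutive M v)
    edge⁻ : ∀ {v} → m⁻ v ≢ v → S v × E v (m⁻ v)
    edge⁻ {v} c with v ≟ t | v ≟ m t
    ... | yes refl | _        = contradiction refl c
    ... | no _     | yes refl = contradiction refl c
    ... | no v≢t   | no v≢mt  = edge M c

  restrict : ∀ {W T : VSet} {m} → Decidable W → Decidable T → IsPerfectMatchingOn E W m →
             Σ[ m' ∈ (Fin n → Fin n) ] (Matching T m' ×
               (∀ {v} → W v → T v → T (m v) → m' v ≡ m v) ×
               (∀ {v} → ¬ (W v × T v × T (m v)) → m' v ≡ v))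
  restrict {W} {T} {m} W? T? pm = m' , record { involutive = inv ; edge = edge' } ,
    (λ w t t' → kept (w , t , t')) , dropped
    where
    C : VSet
    C v = W v × T v × T (m v)
    C? : Decidable C
    C? v = W? v ×-dec T? v ×-dec T? (m v)
    m' : Fin n → Fin n
    m' v with C? v
    ... | yes _ = m v
    ... | no _  = v
    kept : ∀ {v} → C v → m' v ≡ m v
    kept {v} c with C? v
    ... | yes _ = refl
    ... | no ¬c = contradiction c ¬c
    dropped : ∀ {v} → ¬ C v → m' v ≡ v
    dropped {v} ¬c with C? v
    ... | yes c = contradiction c ¬c
    ... | no _  = refl
    inv : ∀ v → m' (m' v) ≡ v
    inv v with C? v
    ... | no ¬c = dropped ¬c
    ... | yes (w , t , t') = let w' , _ , _ , i = pm v w in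
      trans (kept (w' , t' , subst T (sym i) t)) i
    edge' : ∀ {v} → m' v ≢ v → T v × E v (m' v)
    edge' {v} c with C? v
    ... | no _ = contradiction refl c
    ... | yes (w , t , _) = t , proj₁ (proj₂ (pm v w))

  -- Alternating paths

  -- The outcome of switching `N` along an alternating path from `t`. The far end `lost` is the only
  -- vertex missed by `N` that `N*` may cover.
  record Shifted (S : VSet) (N : Fin n → Fin n) (t : Fin n) : Set where
    field
      N*        : Fin n → Fin n
      matching  : Matching S N*
      misses-t  : N* t ≡ t
      same-size : size N* ≡ size N
      lost      : Fin n
      keeps     : ∀ {v} → N v ≡ v → v ≢ lost → N* v ≡ v

  -- Follow the N-N'-alternating path from t; if it ends at a vertex missed
  -- by N, switch N along it, otherwise it augments N'.
  switch-or-augment : ∀ f {S N N' t} → Matching S N → Matching S N' → N' t ≡ t → N t ≢ t → size N ≤ f →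
    Shifted S N t ⊎ (Σ[ N⁺ ∈ (Fin n → Fin n) ] (Matching S N⁺ × size N' < size N⁺))
  switch-or-augment zero {N = N} {t = t} M M' N't Nt sz with size-remove (hasSize-covered N) Nt
  ... | _ , eq , _ = contradiction (ℕₚ.≤-trans (ℕₚ.≤-reflexive (sym eq)) sz) λ ()
  switch-or-augment (suc f) {S} {N} {N'} {t} M M' N't Nt sz = go
    where
    u = N t
    w = N' u
    Nu : N u ≡ t
    Nu = involutive M t
    St : S t
    St = proj₁ (edge M Nt)
    Su : S u
    Su = proj₁ (edge M (covered-closed M Nt))
    Etu : E t u
    Etu = proj₂ (edge M Nt)
    t≢u : t ≢ u
    t≢u = Nt ∘ sym
    open Deletion (delete M Nt) using () renaming
      (m⁻ to N₁; matching to M₁; at-t to N₁t; at-mt to N₁u; agree to N₁-agree; smaller to N₁-smaller)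
    Result : Set
    Result = Shifted S N t ⊎ (Σ[ N⁺ ∈ (Fin n → Fin n) ] (Matching S N⁺ × size N' < size N⁺))
    -- The edge `uw` takes the place of `tu`: added to a matching of `S - t - u` that misses `w`, it
    -- restores the size of `N` and leaves `t` uncovered.
    shift : ∀ {K} → Matching (S ∖ t ∖ u) K → size K ≡ size N₁ → (lost : Fin n) → E u w → S w → K w ≡ w →
            (∀ {v} → N v ≡ v → v ≢ lost → v ≢ w × K v ≡ v) → w ≢ t → Result
    shift {K} MK szK lost Euw Sw Kw keep w≢t = inj₁ (record
      { N* = m⁺ ; matching = matching
      ; misses-t = trans (agree t≢u (w≢t ∘ sym)) (outside-fixed MK λ ((_ , t≢t) , _) → t≢t refl)
      ; same-size = trans bigger (trans (cong (2 +_) szK) (sym N₁-smaller))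
      ; lost = lost
      ; keeps = λ Nv v≢l → let v≢w , Kv = keep Nv v≢l in
          trans (agree (λ { refl → t≢u (trans (sym Nu) Nv) }) v≢w) Kv })
      where open Insertion (insert (matching-mono (proj₁ ∘ proj₁) MK) Su Sw Euw
                                   (outside-fixed MK λ (_ , u≢u) → u≢u refl) Kw)
    go : Result
    go with N' u ≟ u
    ... | yes N'u = inj₂ (m⁺ , matching , ℕₚ.≤-trans (ℕₚ.n≤1+n _) (ℕₚ.≤-reflexive (sym bigger)))
      where open Insertion (insert M' St Su Etu N't N'u)
    ... | no N'u with N w ≟ w
    ...   | yes Nw = shift M₁ refl w (proj₂ (edge M' N'u)) (proj₁ (edge M' (covered-closed M' N'u)))
                       (trans (N₁-agree w≢t N'u) Nw)
                       (λ {v} Nv v≢w → v≢w , trans (N₁-agree (λ { refl → Nt Nv })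
                          (λ { refl → t≢u (trans (sym Nu) Nv) })) Nv)
                       w≢t
      where
      w≢t : w ≢ t
      w≢t eq = t≢u (trans (sym N't) (trans (cong N' (sym eq)) (involutive M' u)))
    -- The path goes on from `w`, with `tu` removed from `N` and `uw` from `N'`. If the shortened
    -- `N'` can be augmented, adding `tu` to the result beats `N'`.
    ...   | no Nw = continue (switch-or-augment f M₁ M₁' N₁'w N₁w
                      (ℕₚ.≤-trans (ℕₚ.n≤1+n _) (s≤s⁻¹ (ℕₚ.≤-trans (ℕₚ.≤-reflexive (sym N₁-smaller)) sz))))
      where
      w≢t : w ≢ t
      w≢t eq = t≢u (trans (sym N't) (trans (cong N' (sym eq)) (involutive M' u)))
      open Deletion (delete M' N'u) using () renaming
        (m⁻ to N₁'; matching to M''; at-t to N₁'u; at-mt to N₁'w; agree to N₁'-agree; smaller to N₁'-smaller)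
      N₁'t : N₁' t ≡ t
      N₁'t = trans (N₁'-agree t≢u (w≢t ∘ sym)) N't
      M₁' : Matching (S ∖ t ∖ u) N₁'
      M₁' = matching-∖ (matching-∖ (matching-mono (proj₁ ∘ proj₁) M'') N₁'t) N₁'u
      N₁w : N₁ w ≢ w
      N₁w q = Nw (trans (sym (N₁-agree w≢t N'u)) q)
      continue : Shifted (S ∖ t ∖ u) N₁ w ⊎
                 (Σ[ N⁺ ∈ (Fin n → Fin n) ] (Matching (S ∖ t ∖ u) N⁺ × size N₁' < size N⁺)) → Result
      continue (inj₁ sh) = shift matching same-size lost (proj₂ (edge M' N'u))
          (proj₁ (edge M' (covered-closed M' N'u))) misses-t
          (λ {v} Nv v≢l → (λ { refl → Nw Nv }) ,
             keeps (trans (N₁-agree (λ { refl → Nt Nv }) (λ { refl → t≢u (trans (sym Nu) Nv) })) Nv) v≢l)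
          w≢t
        where open Shifted sh
      continue (inj₂ (N⁺ , M⁺ , lt)) = inj₂ (m⁺ , matching ,
          subst (size N' <_) (sym bigger) (subst (_< 2 + size N⁺) (sym N₁'-smaller) (ℕₚ.+-monoʳ-< 2 lt)))
        where open Insertion (insert (matching-mono (proj₁ ∘ proj₁) M⁺) St Su Etu
                               (outside-fixed M⁺ λ ((_ , t≢t) , _) → t≢t refl)
                               (outside-fixed M⁺ λ (_ , u≢u) → u≢u refl))

  -- Gallai's lemma and the Tutte-Berge theorem

  Maximum : VSet → (Fin n → Fin n) → Set
  Maximum S N = ∀ {m} → Matching S m → size m ≤ size N

  not-bigger : ∀ {S N m a b} → Maximum S N → size m ≡ size N → Insertion S m a b → ⊥
  not-bigger max eq i = ℕₚ.<⇒≱ (ℕₚ.≤-trans (ℕₚ.≤-reflexive (cong suc (sym eq)))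
    (ℕₚ.≤-trans (ℕₚ.n≤1+n _) (ℕₚ.≤-reflexive (sym bigger)))) (max matching)
    where open Insertion i

  -- For a maximum `N` this is the set D of the Gallai-Edmonds decomposition.
  Inessential : VSet → (Fin n → Fin n) → Fin n → Set
  Inessential S N v = Σ[ m ∈ (Fin n → Fin n) ] (Matching S m × size m ≡ size N × m v ≡ v)

  inessential? : ∀ {S} → Decidable S → ∀ N v → Dec (Inessential S N v)
  inessential? S? N v = any-function? n
    (λ eq (M , sz , fix) → matching-resp eq M , trans (sym (size-resp-≗ eq)) sz , trans (sym (eq v)) fix)
    (λ m → matching? S? m ×-dec (size m ℕₚ.≟ size N) ×-dec (m v ≟ v))

  -- Induction along the walk. Its second vertex `t` is covered by `m`, or the first edge would
  -- augment `m`. Switching `m` towards a maximum matching missing `t` uncovers `t` and covers at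
  -- most one vertex missed before. If that is not `a`, the edge `at` augments; if it is `a` and
  -- `a ≢ b`, then `t` and `b` are both missed, and induction gives `t ≡ b`, which `m` misses.
  gallai : ∀ {S N} → Maximum S N → (∀ {v} → S v → Inessential S N v) →
           ∀ {a b m} → Reach E S a b → Matching S m → size m ≡ size N → m a ≡ a → m b ≡ b → a ≡ b
  gallai max iness (here _) _ _ _ _ = refl
  gallai {S} {N} max iness {a} {b} {m} (step {w = t} sa e p) M sz ma mb with m t ≟ t
  ... | yes mt = ⊥-elim (not-bigger max sz (insert M sa (reach-start p) e ma mt))
  ... | no mt with iness (reach-start p)
  ... | m' , M' , sz' , m't with switch-or-augment (size m) M M' m't mt ℕₚ.≤-refl
  ... | inj₂ (m⁺ , M⁺ , lt) = contradiction (ℕₚ.≤-trans lt (max M⁺)) (ℕₚ.<-irrefl sz')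
  ... | inj₁ sh with a ≟ Shifted.lost sh
  ... | no a≢l = ⊥-elim (not-bigger max (trans same-size sz)
                   (insert matching sa (reach-start p) e (keeps ma a≢l) misses-t))
    where open Shifted sh
  ... | yes refl with a ≟ b
  ...   | yes a≡b = a≡b
  ...   | no a≢b = contradiction
            (subst (λ x → m x ≡ x) (sym (gallai max iness p matching (trans same-size sz) misses-t (keeps mb (a≢b ∘ sym)))) mb) mt
    where open Shifted sh

  -- The Tutte–Berge certificate of a matching N: the missed vertices and
  -- the partners of Z lie in different components of S ∖ Z.

  Base : (Fin n → Fin n) → VSet → VSet
  Base N Z a = N a ≡ a ⊎ Z (N a)

  record Certificate (S : VSet) (N : Fin n → Fin n) (Z : VSet) : Set where
    field
      Z?       : Decidable Z
      inside-S : ∀ {z} → Z z → S z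
      covered  : ∀ {z} → Z z → N z ≢ z
      crosses  : ∀ {z} → Z z → ¬ Z (N z)
      separate : ∀ {a b} → Base N Z a → Base N Z b → Reach E (λ w → S w × ¬ Z w) a b → a ≡ b

  -- Deleting the edge at `v` turns `N v` into a missed vertex. The base of the smaller certificate
  -- thus already contains the partner of the new element `v`.
  certificate-extend : ∀ {S N v} (M : Matching S N) (c : N v ≢ v) →
    ∀ {Z} → Certificate (S ∖ v) (Deletion.m⁻ (delete M c)) Z → Certificate S N (λ w → Z w ⊎ w ≡ v)
  certificate-extend {S} {N} {v} M c {Z} cert = record
    { Z?       = λ w → Z? w ⊎-dec (w ≟ v)
    ; inside-S = λ { (inj₁ z) → proj₁ (inside-S z) ; (inj₂ refl) → proj₁ (edge M c) }
    ; covered  = λ { (inj₁ z) eq → covered z (trans (same z) eq) ; (inj₂ refl) → c }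
    ; crosses  = λ where
        (inj₁ z) (inj₁ z')   → crosses z (subst Z (sym (same z)) z')
        (inj₁ z) (inj₂ eq)   → ≢Nv z (trans (sym (involutive M _)) (cong N eq))
        (inj₂ refl) (inj₁ z) → ≢Nv z refl
        (inj₂ refl) (inj₂ q) → c q
    ; separate = λ ba bb p → separate (base ba) (base bb)
        (reach-mono (λ (s , ¬z) → (s , ¬z ∘ inj₂) , ¬z ∘ inj₁) p) }
    where
    open Deletion (delete M c)
    open Certificate cert
    ≢v : ∀ {z} → Z z → z ≢ v
    ≢v z refl = covered z at-t
    ≢Nv : ∀ {z} → Z z → z ≢ N v
    ≢Nv z refl = covered z at-mt
    same : ∀ {z} → Z z → m⁻ z ≡ N z
    same z = agree (≢v z) (≢Nv z)
    base : ∀ {a} → Base N (λ w → Z w ⊎ w ≡ v) a → Base m⁻ Z a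
    base {a} (inj₁ Na) = inj₁ (trans (agree (λ { refl → c Na }) λ { refl → covered-closed M c Na }) Na)
    base {a} (inj₂ (inj₁ z)) = inj₂ (subst Z
      (sym (agree (λ { refl → ≢Nv z refl }) λ { refl → ≢v z (involutive M v) })) z)
    base {a} (inj₂ (inj₂ eq)) with trans (sym (involutive M a)) (cong N eq)
    ... | refl = inj₁ at-mt

  -- A matching of `S - v` is one of `S` missing the essential vertex `v`, so it is smaller than
  -- `N`, and by parity smaller by at least 2.
  maximum-delete : ∀ {S N v} (M : Matching S N) (c : N v ≢ v) → Maximum S N →
    ¬ Inessential S N v → Maximum (S ∖ v) (Deletion.m⁻ (delete M c))
  maximum-delete {S} {N} {v} M c max ess {m} Mm = s≤s⁻¹ (s≤s⁻¹
    (subst (2 + size m ≤_) smaller (even-<  (size-even Mm) (size-even M)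
      (ℕₚ.≤∧≢⇒< (max Mm⁺) λ eq → ess (m , Mm⁺ , eq , outside-fixed Mm λ (_ , v≢v) → v≢v refl)))))
    where
    open Deletion (delete M c)
    Mm⁺ : Matching S m
    Mm⁺ = matching-mono proj₁ Mm
    even-< : ∀ {a b} → Even a → Even b → a < b → 2 + a ≤ b
    even-< ea eb a<b = even-≤ (even-suc-suc ea) eb (s≤s a<b)

  -- Essential vertices are moved into `Z` one at a time. Once none remains, Gallai's lemma says
  -- that the empty set is a certificate.
  berge : ∀ k {S N} → HasSize S k → Matching S N → Maximum S N → Σ[ Z ∈ VSet ] Certificate S N Z
  berge k {S} {N} h M max
    with any? (λ v → sized⇒decidable h v ×-dec ¬? (inessential? (sized⇒decidable h) N v))
  ... | yes (v , sv , ess) with k | size-remove h sv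
  ... | suc k' | _ , refl , h' = _ , certificate-extend M c (proj₂ (berge k' h'
          (matching-mono proj₁ matching) (maximum-delete M c max ess)))
    where
    c : N v ≢ v
    c Nv = ess (N , M , refl , Nv)
    open Deletion (delete M c)
  berge k {S} {N} h M max | no none = (λ _ → ⊥) , record
    { Z? = λ _ → no id ; inside-S = λ () ; covered = λ () ; crosses = λ ()
    ; separate = λ where
        (inj₁ Na) (inj₁ Nb) p → gallai max
          (λ {v} s → decidable-stable (inessential? (sized⇒decidable h) N v) λ ¬i → none (v , s , ¬i))
          (reach-mono proj₁ p) M refl Na Nb }

-- Barriers and their odd components

module Barriers (G : Graph) where
  open GraphNotions G
  open Counting G
  open Matchings G

  pm-∖∖ : ∀ {T : VSet} {m v} → IsPerfectMatchingOn E T m → T v → IsPerfectMatchingOn E (T ∖ v ∖ m v) m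
  pm-∖∖ {m = m} {v} p Tv w ((Tw , w≢v) , w≢mv) with p w Tw
  ... | c , e , nf , i = ((c , λ q → w≢mv (trans (sym i) (cong m q)))
                           , λ q → w≢v (trans (sym i) (trans (cong m q) (proj₂ (proj₂ (proj₂ (p v Tv)))))))
                         , e , nf , i

  -- Follow the M-N-alternating path from v until it meets another vertex
  -- missed by N, and switch M along it.
  alternate : ∀ k {T M N v} → HasSize T k → IsPerfectMatchingOn E T M → Matching T N → T v → N v ≡ v →
              ∃[ p ] (T p × p ≢ v × N p ≡ p × Factorizable E (T ∖ v ∖ p))
  alternate k {T} {M} {N} {v} h pm MN Tv Nv with pm v Tv
  ... | Tw , e , w≢v , Mw with N (M v) ≟ M v
  ... | yes Nw = M v , Tw , w≢v , Nw , M , pm-∖∖ pm Tv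
  ... | no Nw with k | size-remove h Tv
  ... | suc k₁ | _ , refl , h₁ with k₁ | size-remove h₁ (Tw , w≢v)
  -- The search continues from `w'`, the `N`-partner of `w = M v`, after removing `v` and `w`; the
  -- edge `ww'` of `N` is put back into the final matching.
  ... | suc k₂ | _ , refl , h₂ = conclude (alternate k₂ h₂ (pm-∖∖ pm Tv) MN' Tw' at-mt)
    where
    open Matching MN
    w = M v
    w' = N w
    open Deletion (delete MN Nw)
    w'≢v : w' ≢ v
    w'≢v q = w≢v (trans (sym (involutive w)) (trans (cong N q) Nv))
    Tw' : (T ∖ v ∖ w) w'
    Tw' = (proj₁ (edge (covered-closed Nw)) , w'≢v) , Nw
    MN' : Matching (T ∖ v ∖ w) m⁻
    MN' = matching-∖ (matching-∖ (matching-mono (proj₁ ∘ proj₁) matching)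
            (trans (agree (w≢v ∘ sym) (w'≢v ∘ sym)) Nv)) at-t
    conclude : ∃[ p ] ((T ∖ v ∖ w) p × p ≢ w' × m⁻ p ≡ p × Factorizable E (T ∖ v ∖ w ∖ w' ∖ p)) →
               ∃[ p ] (T p × p ≢ v × N p ≡ p × Factorizable E (T ∖ v ∖ p))
    conclude (p , ((Tp , p≢v) , p≢w) , p≢w' , fix , F) =
      p , Tp , p≢v , trans (sym (agree p≢w p≢w')) fix ,
      factorizable-resp
        (λ { (inj₁ (inj₁ refl)) → (Tw , w≢v) , p≢w ∘ sym
           ; (inj₁ (inj₂ refl)) → (proj₁ (edge (covered-closed Nw)) , w'≢v) , p≢w' ∘ sym
           ; (inj₂ ((((Tx , x≢v) , _) , _) , x≢p)) → (Tx , x≢v) , x≢p })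
        (λ {x} ((Tx , x≢v) , x≢p) → split x Tx x≢v x≢p)
        (factorizable-∪ (λ x → (x ≟ w) ⊎-dec (x ≟ w'))
          (λ { (inj₁ refl) (((_ , x≢w) , _) , _) → x≢w refl
             ; (inj₂ refl) ((_ , x≢w') , _) → x≢w' refl })
          (factorizable-edge (proj₂ (edge Nw))) F)
      where
      split : ∀ x → T x → x ≢ v → x ≢ p → (x ≡ w ⊎ x ≡ w') ⊎ (T ∖ v ∖ w ∖ w' ∖ p) x
      split x Tx x≢v x≢p with x ≟ w | x ≟ w'
      ... | yes q | _     = inj₁ (inj₁ q)
      ... | no _  | yes q = inj₁ (inj₂ q)
      ... | no a  | no b  = inj₂ ((((Tx , x≢v) , a) , b) , x≢p)

  hasSize-All : HasSize All n
  hasSize-All = Sub.⊤ , (λ v → (λ _ → tt) , λ _ → Subₚ.∈⊤) , Subₚ.∣⊤∣≡n n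

  -- If r is the only vertex of K missed by N and K − v has no perfect
  -- matching, then v is essential.
  near-perfect-dual : ∀ {K N r v} → Decidable K → Matching K N → K r → N r ≡ r → K ∖ r ⊆ Covered N →
                      K v → ¬ Factorizable E (K ∖ v) → Σ[ Z ∈ VSet ] (Certificate K N Z × Z v)
  near-perfect-dual {K} {N} {r} {v} K? MN Kr Nr cover Kv ¬F =
    (λ w → proj₁ dual w ⊎ w ≡ v) , certificate-extend MN Nv (proj₂ dual) , inj₂ refl
    where
    K-size : ∃ (HasSize K)
    K-size = sized K?
    K∖-size : ∀ {u} → K u → HasSize (K ∖ u) (size N)
    K∖-size {u} Ku = same-size (size-remove (proj₂ K-size) Ku) (size-remove (proj₂ K-size) Kr)
      where
      same-size : ∃[ a ] (proj₁ K-size ≡ suc a × HasSize (K ∖ u) a) →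
                  ∃[ b ] (proj₁ K-size ≡ suc b × HasSize (K ∖ r) b) → HasSize (K ∖ u) (size N)
      same-size (a , eqa , ha) (b , eqb , hb) = subst (HasSize (K ∖ u))
        (trans (ℕₚ.suc-injective (trans (sym eqa) eqb))
               (size-unique (size-resp cover (λ c → proj₁ (Matching.edge MN c) , λ { refl → c Nr }) hb)
                            (hasSize-covered N))) ha
    maximum : Maximum K N
    maximum {m} M with size-remove (proj₂ K-size) Kr
    -- `K` has one vertex more than `N` covers, and parity rules out a matching using it.
    ... | b , eqb , hb = even-≤ (size-even M) (size-even MN)
      (ℕₚ.≤-trans (size-mono (hasSize-covered m) (proj₂ K-size) (proj₁ ∘ Matching.edge M))
        (ℕₚ.≤-reflexive (trans eqb (cong suc (size-unique hb (K∖-size Kr))))))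
    -- A matching as large as `N` that misses `v` would cover all of `K - v`.
    essential : ¬ Inessential K N v
    essential (m , M , eq , mv) = ¬F (m , λ w k → let c = full k in
        full⁻ (Matching.covered-closed M c) , proj₂ (Matching.edge M c) , c , Matching.involutive M w)
      where
      full⁻ : Covered m ⊆ K ∖ v
      full⁻ c = proj₁ (Matching.edge M c) , λ { refl → c mv }
      full : K ∖ v ⊆ Covered m
      full = size-antisym (hasSize-covered m) (K∖-size Kv) (ℕₚ.≤-reflexive (sym eq)) full⁻
    Nv : N v ≢ v
    Nv fix = essential (N , MN , refl , fix)
    dual : Σ[ Z ∈ VSet ] Certificate (K ∖ v) (Deletion.m⁻ (delete MN Nv)) Z
    dual = berge _ (proj₂ (sized (∖? K? v)))
      (matching-mono proj₁ (Deletion.matching (delete MN Nv))) (maximum-delete MN Nv maximum essential)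

  -- Barriers through a perfect matching m: X is a barrier exactly if m maps
  -- X to representatives of pairwise different components of G − X.

  record Certified (m : Fin n → Fin n) (X : VSet) : Set where
    field
      crosses  : ∀ {x} → X x → ¬ X (m x)
      separate : ∀ {x y} → X x → X y → Reach E (∁ X) (m x) (m y) → x ≡ y

  abstract
    -- By parity some `N`-edge leaves the component, and an edge leaving a component of `G - X` ends
    -- in `X`.
    leave : ∀ {X W : VSet} {N v k} → Decidable X → IsPerfectMatchingOn E W N →
            HasSize (Reach E (∁ X) v) k → Odd k → Reach E (∁ X) v ⊆ W →
            ∃[ z ] (Reach E (∁ X) v z × X (N z))
    leave {X = X} {N = N} X? p h odd sub
      with odd⇒leaves {m = N} h odd (λ r → proj₂ (proj₂ (proj₂ (p _ (sub r))))) (λ r → proj₁ (proj₂ (proj₂ (p _ (sub r)))))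
    ... | z , r , ¬r = z , r , decidable-stable (X? (N z)) λ ¬x → ¬r (reach-snoc r (proj₁ (proj₂ (p z (sub r)))) ¬x)

  MaxDeficiencyZero : Set₁
  MaxDeficiencyZero = ∃[ ν ] (MaxMatchingSize ν × n ≡ 2 * ν)

  module PerfectMatching {m : Fin n → Fin n} (pm : IsPerfectMatchingOn E All m) where

    m-edge : ∀ v → E v (m v)
    m-edge v = proj₁ (proj₂ (pm v tt))

    m-no-fixed : ∀ v → m v ≢ v
    m-no-fixed v = proj₁ (proj₂ (proj₂ (pm v tt)))

    m-involutive : ∀ v → m (m v) ≡ v
    m-involutive v = proj₂ (proj₂ (proj₂ (pm v tt)))

    m-injective : ∀ {u v} → m u ≡ m v → u ≡ v
    m-injective {u} {v} eq = trans (sym (m-involutive u)) (trans (cong m eq) (m-involutive v))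

    pm-on : ∀ {P : VSet} → (∀ {v} → P v → P (m v)) → IsPerfectMatchingOn E P m
    pm-on c v p = c p , m-edge v , m-no-fixed v , m-involutive v

    barrier⇒perfect : ∀ {X} → Barrier X → MaxDeficiencyZero
    barrier⇒perfect (ν , _ , _ , maxν@((_ , _ , _ , hW) , max) , _)
      with involution⇒even hasSize-All (record
             { closed = λ _ → tt ; involutive = λ _ → m-involutive _ ; no-fixed = λ _ → m-no-fixed _ })
    ... | j , n≡2j = ν , maxν , ℕₚ.≤-antisym
      (ℕₚ.≤-trans (ℕₚ.≤-reflexive n≡2j) (ℕₚ.*-monoʳ-≤ 2 (max All m j pm (subst (HasSize All) n≡2j hasSize-All))))
      (size-≤n hW)

    -- The perfect matching makes the deficiency zero, so the barrier equation says that there are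
    -- as many odd components as elements of `X`.
    barrier-balanced : ∀ {X} → Barrier X → ∃[ k ] (OddCompCount X k × HasSize X k)
    barrier-balanced b@(ν , q , x , maxν , hq , hx , eq) with barrier⇒perfect b
    ... | ν' , maxν' , n≡2ν' with ℕₚ.≤-antisym
            (let (W , m₁ , p₁ , h₁) , _ = maxν in proj₂ maxν' W m₁ ν p₁ h₁)
            (let (W , m₁ , p₁ , h₁) , _ = maxν' in proj₂ maxν W m₁ ν' p₁ h₁)
    ... | refl with ℤₚ.+-injective (ℤₚ.i-j≡0⇒i≡j (ℤ.+ q) (ℤ.+ x) (trans eq (ℤₚ.i≡j⇒i-j≡0 (cong (λ k → ℤ.+ k) n≡2ν'))))
    ... | refl = q , hq , hx

    abstract
      odd-component⇒partner : ∀ {X v} → Decidable X → D X v → ∃[ x ] (X x × Reach E (∁ X) v (m x))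
      odd-component⇒partner {X} X? (_ , k , h , odd) with leave X? pm h odd (λ _ → tt)
      ... | z , r , x = m z , x , subst (Reach E (∁ X) _) (sym (m-involutive z)) r

    -- Relate an odd component to the `x ∈ X` with `m x` in it. By parity each odd component has
    -- such an `x`, and no `x` serves two of them. As the numbers agree, the relation is a
    -- bijection.
    barrier⇒certified : ∀ {X} → Barrier X → Certified m X
    barrier⇒certified {X} b with barrier-balanced b
    ... | k , hq , hx = record
      { crosses  = λ x x' → let v , _ , r = component x in reach-end r x'
      ; separate = λ {x} {y} Xx Xy r →
          let v , qv , rv = component Xx ; v' , qv' , rv' = component Xy
              vv' = reach-trans rv (reach-trans r (reach-sym rv'))
              eq = Finₚ.≤-antisym (proj₂ qv v' vv') (proj₂ qv' v (reach-sym vv'))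
          in unique qv qv' eq rv rv' Xx Xy }
      where
      X? = sized⇒decidable hx
      R = Reach E (∁ X)
      Q : VSet
      Q v = D X v × (∀ w → R v w → v ≤ᶠ w)
      F : Fin n → Fin n → Set
      F v x = R v (m x)
      total : ∀ {v} → Q v → ∃[ x ] (X x × F v x)
      total (d , _) = odd-component⇒partner X? d
      injective : ∀ {v v' x} → Q v → Q v' → F v x → F v' x → v ≡ v'
      injective {v} {v'} (_ , min) (_ , min') r r' =
        Finₚ.≤-antisym (min v' (reach-trans r (reach-sym r'))) (min' v (reach-trans r' (reach-sym r)))
      component : ∀ {x} → X x → ∃[ v ] (Q v × F v x)
      component = injection⇒onto hq hx F total injective ℕₚ.≤-refl
      unique : ∀ {v v' x y} → Q v → Q v' → v ≡ v' → F v x → F v' y → X x → X y → x ≡ y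
      unique q _ refl f f' x y = injection⇒functional hq hx F total injective ℕₚ.≤-refl q x y f f'

    module _ {X : VSet} (X? : Decidable X) (cert : Certified m X) where
      open Certified cert

      -- If `v ≢ m x` in the component had `m v ∈ X`, then `x` and `m v` would have their partners
      -- in the same component.
      component-involution : ∀ {x} → X x → Involution (Reach E (∁ X) (m x) ∖ m x) m
      component-involution {x} Xx = record
        { closed     = λ {v} (r , v≢mx) →
            reach-snoc r (m-edge v) (λ Xmv → v≢mx (trans (sym (m-involutive v)) (cong m (sym
              (separate Xx Xmv (subst (Reach E (∁ X) (m x)) (sym (m-involutive v)) r))))))
            , λ eq → reach-end r (subst X (sym (m-injective eq)) Xx)
        ; involutive = λ _ → m-involutive _
        ; no-fixed   = λ _ → m-no-fixed _ }

      abstract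
        component-odd : ∀ {x k} → X x → HasSize (Reach E (∁ X) (m x)) k → Odd k
        component-odd Xx h = involution⇒odd h (here (crosses Xx)) (component-involution Xx)

      abstract
        partner⇒odd-component : ∀ {x v} → X x → Reach E (∁ X) v (m x) → D X v
        partner⇒odd-component {x} Xx r with sized (reach? (¬? ∘ X?) (m x))
        ... | k , h = reach-start r , k , size-resp (reach-trans r) (reach-trans (reach-sym r)) h
                    , component-odd Xx h

      D? : Decidable (D X)
      D? v = map′ (λ (x , Xx , r) → partner⇒odd-component Xx r) (odd-component⇒partner X?)
                  (any? λ x → X? x ×-dec reach? (¬? ∘ X?) v (m x))

      -- Each odd component contains some `m x`, and each `m x` has an odd component of its own; the
      -- two injections show that `X` and the odd components are equinumerous.
      certified⇒barrier : MaxDeficiencyZero → Barrier X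
      certified⇒barrier (ν , maxν , n≡2ν) with sized X? | sized Q?
        where
        Q? = λ v → D? v ×-dec all? (λ w → reach? (¬? ∘ X?) v w →-dec (v Finₚ.≤? w))
      ... | x , hx | q , hq = ν , q , x , maxν , hq , hx ,
        trans (ℤₚ.i≡j⇒i-j≡0 (cong (λ k → ℤ.+ k) (ℕₚ.≤-antisym
                (injection⇒≤ hq hx (λ v y → Reach E (∁ X) v (m y))
                  (λ (d , _) → odd-component⇒partner X? d)
                  λ (_ , min) (_ , min') r r' → Finₚ.≤-antisym (min _ (reach-trans r (reach-sym r')))
                                                               (min' _ (reach-trans r' (reach-sym r))))
                (injection⇒≤ hx hq (λ y v → Reach E (∁ X) v (m y)) least-vertex
                  λ Xy Xy' r r' → separate Xy Xy' (reach-trans (reach-sym r) r')))))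
              (sym (ℤₚ.i≡j⇒i-j≡0 (cong (λ k → ℤ.+ k) n≡2ν)))
        where
        least-vertex : ∀ {y} → X y → ∃[ v ] ((D X v × (∀ w → Reach E (∁ X) v w → v ≤ᶠ w)) × Reach E (∁ X) v (m y))
        least-vertex {y} Xy with least (reach? (¬? ∘ X?) (m y)) (here (crosses Xy))
        ... | v , r , min = v , (partner⇒odd-component Xy (reach-sym r) , λ w r' → min w (reach-trans r r'))
                              , reach-sym r

      -- Only the component `K` of `m x` is cut further. The base of the certificate includes `m x`,
      -- which `N` misses, and the vertices `m z` with `z ∈ Z`, so these lie in different components
      -- of `K - Z`.
      certified-extend : ∀ {N Z x} → X x → Matching (Reach E (∁ X) (m x)) N → N (m x) ≡ m x →
        (∀ {w} → (Reach E (∁ X) (m x) ∖ m x) w → N w ≡ m w) →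
        Certificate (Reach E (∁ X) (m x)) N Z → Certified m (X ∪ Z)
      certified-extend {N} {Z} {x} Xx MN N-mx N-inside dual = record { crosses = cr ; separate = se }
        where
        K : VSet
        K = Reach E (∁ X) (m x)
        open Certificate dual using (Z?; inside-S; covered)
          renaming (crosses to Z-crosses; separate to Z-separate)
        Z⊆K∖mx : Z ⊆ K ∖ m x
        Z⊆K∖mx z = inside-S z , λ { refl → covered z N-mx }
        N≡m : ∀ {z} → Z z → N z ≡ m z
        N≡m z = N-inside (Z⊆K∖mx z)
        Kmx : K (m x)
        Kmx = here (crosses Xx)
        Kmz : ∀ {z} → Z z → K (m z)
        Kmz z = proj₁ (Involution.closed (component-involution Xx) (Z⊆K∖mx z))
        base-z : ∀ {z} → Z z → Base N Z (m z)
        base-z {z} Zz = inj₂ (subst Z (sym (trans (cong N (sym (N≡m Zz))) (Matching.involutive MN z))) Zz)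
        ∁-∪ : ∁ (X ∪ Z) ⊆ ∁ X
        ∁-∪ ¬xz = ¬xz ∘ inj₁
        within-K : ∀ {a b} → K a → Reach E (∁ (X ∪ Z)) a b → Reach E (λ w → K w × ¬ Z w) a b
        within-K Ka (here ¬xz)     = here (Ka , ¬xz ∘ inj₂)
        within-K Ka (step ¬xz e r) = step (Ka , ¬xz ∘ inj₂) e (within-K (reach-snoc Ka e (∁-∪ (reach-start r))) r)
        mixed : ∀ {y z} → X y → Z z → Reach E (∁ (X ∪ Z)) (m y) (m z) → y ≡ z
        mixed {y} Xy Zz r with separate Xy Xx (reach-trans (reach-mono ∁-∪ r) (reach-sym (Kmz Zz)))
        ... | refl = m-injective (Z-separate (inj₁ N-mx) (base-z Zz) (within-K Kmx r))
        cr : ∀ {y} → (X ∪ Z) y → ¬ (X ∪ Z) (m y)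
        cr (inj₁ Xy) (inj₁ Xmy) = crosses Xy Xmy
        cr (inj₁ Xy) (inj₂ Zmy) with separate Xy Xx (reach-sym (inside-S Zmy))
        ... | refl = covered Zmy N-mx
        cr (inj₂ Zy) (inj₁ Xmy) = reach-end (Kmz Zy) Xmy
        cr (inj₂ Zy) (inj₂ Zmy) = Z-crosses Zy (subst Z (sym (N≡m Zy)) Zmy)
        se : ∀ {y z} → (X ∪ Z) y → (X ∪ Z) z → Reach E (∁ (X ∪ Z)) (m y) (m z) → y ≡ z
        se (inj₁ Xy) (inj₁ Xz) r = separate Xy Xz (reach-mono ∁-∪ r)
        se (inj₁ Xy) (inj₂ Zz) r = mixed Xy Zz r
        se (inj₂ Zy) (inj₁ Xz) r = sym (mixed Xz Zy (reach-sym r))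
        se (inj₂ Zy) (inj₂ Zz) r = m-injective (Z-separate (base-z Zy) (base-z Zz) (within-K (Kmz Zy) r))

    odd-maximal⇒factor-critical : ∀ {X} → OddMaximalBarrier X → ∀ {x v} → X x → Reach E (∁ X) (m x) v →
                                  Factorizable E (Reach E (∁ X) (m x) ∖ v)
    odd-maximal⇒factor-critical {X} (bar , maximal) {x} {v} Xx Kv =
      -- Cut down to `K`, the matching `m` misses only `m x`, whose partner `x` is in `X`.
      decidable-stable (factorizable? (∖? K? v)) (impossible (restrict (λ _ → yes tt) K? pm))
      where
      cert = barrier⇒certified bar
      open Certified cert
      X? : Decidable X
      X? = sized⇒decidable (proj₂ (proj₂ (barrier-balanced bar)))
      K : VSet
      K = Reach E (∁ X) (m x)
      K? : Decidable K
      K? = reach? (¬? ∘ X?) (m x)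
      K-closed : ∀ {w} → (K ∖ m x) w → K (m w)
      K-closed = proj₁ ∘ Involution.closed (component-involution X? cert Xx)
      impossible : Σ[ N ∈ (Fin n → Fin n) ] (Matching K N ×
                     (∀ {w} → All w → K w → K (m w) → N w ≡ m w) ×
                     (∀ {w} → ¬ (All w × K w × K (m w)) → N w ≡ w)) →
                   ¬ ¬ Factorizable E (K ∖ v)
      impossible (N , MN , kept , dropped) ¬F =
        extend (near-perfect-dual K? MN (here (crosses Xx)) N-mx
                 (λ k eq → m-no-fixed _ (trans (sym (N-inside k)) eq)) Kv ¬F)
        where
        N-inside : ∀ {w} → (K ∖ m x) w → N w ≡ m w
        N-inside k = kept tt (proj₁ k) (K-closed k)
        N-mx : N (m x) ≡ m x
        N-mx = dropped λ (_ , _ , Kx) → reach-end Kx (subst X (sym (m-involutive x)) Xx)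
        extend : ¬ (Σ[ Z ∈ VSet ] (Certificate K N Z × Z v))
        extend (Z , dual , Zv) = maximal (Z , (v , Zv) ,
          (λ z → partner⇒odd-component X? cert Xx (reach-sym (Certificate.inside-S dual z))) ,
          certified⇒barrier (λ w → X? w ⊎-dec Certificate.Z? dual w)
            (certified-extend X? cert Xx MN N-mx N-inside dual) (barrier⇒perfect bar))

-- Allowed edges and factor-components

module FactorComponents (G : Graph) where
  open GraphNotions G
  open Counting G
  open Matchings G
  open Barriers G

  allowed-sym : ∀ {u v} → Allowed u v → Allowed v u
  allowed-sym (e , m , pm , refl) = E-sym e , m , pm , proj₂ (proj₂ (proj₂ (pm _ tt)))

  pm⇒allowed : ∀ {m} → IsPerfectMatchingOn E All m → ∀ v → Allowed v (m v)
  pm⇒allowed pm v = proj₁ (proj₂ (pm v tt)) , _ , pm , refl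

  areach-trans : ∀ {u v w} → AReach u v → AReach v w → AReach u w
  areach-trans here       q = q
  areach-trans (step a p) q = step a (areach-trans p q)

  areach-sym : ∀ {u v} → AReach u v → AReach v u
  areach-sym here       = here
  areach-sym (step a p) = areach-trans (areach-sym p) (step (allowed-sym a) here)

  allowed⇒areach : ∀ {u v} → Allowed u v → AReach u v
  allowed⇒areach a = step a here

  areach-invariant : ∀ {Q : Pred (Fin n) ℓ} → (∀ {a b} → Q a → Allowed a b → Q b) →
                     ∀ {u v} → Q u → AReach u v → Q v
  areach-invariant c q here       = q
  areach-invariant c q (step a p) = areach-invariant c (c q a) p

  abstract
    areach? : ∀ u v → Dec (AReach u v)
    areach? u v = map′ to from (star? allowed? u v)
      where
      allowed? : ∀ u v → Dec (Allowed u v)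
      allowed? u v = E-dec u v ×-dec any-function? n
        (λ eq (pm , mu) → pm-resp eq pm , trans (sym (eq u)) mu)
        (λ m → pm? (λ _ → yes tt) m ×-dec (m u ≟ v))
      to : ∀ {u v} → Star Allowed u v → AReach u v
      to ε       = here
      to (a ◅ p) = step a (to p)
      from : ∀ {u v} → AReach u v → Star Allowed u v
      from here       = ε
      from (step a p) = a ◅ from p

  -- Certification is assumed for every perfect matching because `arc-back⇒areach` plays `m` off
  -- against a second one.
  module Cells {X : VSet} {m} (pm : IsPerfectMatchingOn E All m) (X? : Decidable X)
    (certified : ∀ {m'} → IsPerfectMatchingOn E All m' → Certified m' X)
    (factor-critical : ∀ {x v} → X x → Reach E (∁ X) (m x) v → Factorizable E (Reach E (∁ X) (m x) ∖ v)) where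

    open PerfectMatching pm
    private
      cert = certified pm
    open Certified cert

    K : Fin n → VSet
    K x = Reach E (∁ X) (m x)

    K? : ∀ x → Decidable (K x)
    K? x = reach? (¬? ∘ X?) (m x)

    K∩X : ∀ {x v} → K x v → X v → ⊥
    K∩X = reach-end

    K-unique : ∀ {x y v} → X x → X y → K x v → K y v → x ≡ y
    K-unique Xx Xy k k' = separate Xx Xy (reach-trans k (reach-sym k'))

    m∈K : ∀ {x} → X x → K x (m x)
    m∈K Xx = here (crosses Xx)

    K-closed : ∀ {x v} → X x → K x v → v ≢ m x → K x (m v)
    K-closed Xx k v≢mx = proj₁ (Involution.closed (component-involution X? cert Xx) (k , v≢mx))

    -- The odd components K x with x ∈ Q have all their neighbours in Q, so
    -- each sends an N-edge to Q and these edges exhaust Q.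
    abstract
      hall : ∀ {Q W : VSet} {N} → Decidable Q → Q ⊆ X →
             (∀ {x z y} → Q x → K x z → E z y → X y → Q y) →
             IsPerfectMatchingOn E W N → (∀ {x} → Q x → K x ⊆ W) →
             ∀ {y} → Q y → W y × ∃[ x ] (Q x × K x (N y))
      hall {Q} {W} {N} Q? Q⊆X closed pN K⊆W Qy with sized Q?
      ... | q , hQ = partner (injection⇒onto hQ hQ F total injective ℕₚ.≤-refl Qy)
        where
        F : Fin n → Fin n → Set
        F x y = ∃[ z ] (K x z × W z × N z ≡ y)
        total : ∀ {x} → Q x → ∃[ y ] (Q y × F x y)
        total {x} Qx with sized (K? x)
        ... | k , hK with leave X? pN hK (component-odd X? cert (Q⊆X Qx) hK) (K⊆W Qx)
        -- The odd set `K x` must send an `N`-edge into `X`, and closedness places its end in `Q`.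
        ... | z , k , XNz = N z , closed Qx k (proj₁ (proj₂ (pN z (K⊆W Qx k)))) XNz , z , k , K⊆W Qx k , refl
        N-injective : ∀ {u v} → W u → W v → N u ≡ N v → u ≡ v
        N-injective Wu Wv eq = trans (sym (proj₂ (proj₂ (proj₂ (pN _ Wu)))))
          (trans (cong N eq) (proj₂ (proj₂ (proj₂ (pN _ Wv)))))
        injective : ∀ {x x' y} → Q x → Q x' → F x y → F x' y → x ≡ x'
        injective Qx Qx' (z , k , Wz , eq) (z' , k' , Wz' , eq')
          with N-injective Wz Wz' (trans eq (sym eq'))
        ... | refl = K-unique (Q⊆X Qx) (Q⊆X Qx') k k'
        partner : ∀ {y} → ∃[ x ] (Q x × F x y) → W y × ∃[ x ] (Q x × K x (N y))
        partner (x , Qx , z , k , Wz , refl) with pN z Wz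
        ... | c , _ , _ , i = c , x , Qx , subst (K x) (sym i) k

    -- Arcs on X and strong connectivity

    Arc : Fin n → Fin n → Set
    Arc x y = X x × X y × ∃[ z ] (K x z × E z y)

    Path : Fin n → Fin n → Set
    Path = Star Arc

    abstract
      path? : ∀ x y → Dec (Path x y)
      path? = star? λ x y → X? x ×-dec X? y ×-dec any? λ z → K? x z ×-dec E-dec z y

    abstract
      -- The Hall count is applied to all vertices of `X` that paths from `x` reach. It puts the
      -- partner of `x` into `K y` for one of them, and the matching edge read backwards is an arc
      -- from `y` to `x`.
      allowed-at-X : ∀ {x z} → X x → Allowed x z → ∃[ y ] (X y × K y z × Path x y × Path y x)
      allowed-at-X {x} Xx (e , m' , pm' , refl)
        with hall {Q = λ y → X y × Path x y} (λ y → X? y ×-dec path? x y) proj₁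
               (λ (Xr , p) k e Xy → Xy , p ◅◅ ((Xr , Xy , _ , k , e) ◅ ε)) pm' (λ _ _ → tt) (Xx , ε)
      ... | _ , y , (Xy , p) , k = y , Xy , k , p , (Xy , Xx , _ , k , E-sym e) ◅ ε

    -- Cells of different `y ∈ X` are disjoint and closed under `m`; the vertices in none of them
    -- form C_X.
    Cell : Fin n → VSet
    Cell y v = v ≡ y ⊎ K y v

    cell? : ∀ y → Decidable (Cell y)
    cell? y v = (v ≟ y) ⊎-dec K? y v

    cell-closed : ∀ {x v} → X x → Cell x v → Cell x (m v)
    cell-closed Xx (inj₁ refl) = inj₂ (m∈K Xx)
    cell-closed {x} {v} Xx (inj₂ k) with v ≟ m x
    ... | yes refl  = inj₁ (m-involutive x)
    ... | no  v≢mx = inj₂ (K-closed Xx k v≢mx)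

    cell-unique : ∀ {x y v} → X x → X y → Cell x v → Cell y v → x ≡ y
    cell-unique Xx Xy (inj₁ refl) (inj₁ refl) = refl
    cell-unique Xx Xy (inj₁ refl) (inj₂ k)    = ⊥-elim (K∩X k Xx)
    cell-unique Xx Xy (inj₂ k)    (inj₁ refl) = ⊥-elim (K∩X k Xy)
    cell-unique Xx Xy (inj₂ k)    (inj₂ k')   = K-unique Xx Xy k k'

    abstract
      cell-allowed : ∀ {y v w} → X y → Cell y v → Allowed v w →
                     ∃[ y' ] (X y' × Cell y' w × Path y y' × Path y' y)
      cell-allowed Xy (inj₁ refl) a with allowed-at-X Xy a
      ... | y' , Xy' , k , p , q = y' , Xy' , inj₂ k , p , q
      cell-allowed {y} {v} {w} Xy (inj₂ k) a with X? w
      ... | no ¬Xw = y , Xy , inj₂ (reach-snoc k (proj₁ a) ¬Xw) , ε , ε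
      -- The edge is read from its end `w` in `X`; the component found for its other end must be
      -- `K y`.
      ... | yes Xw with allowed-at-X Xw (allowed-sym a)
      ... | y' , Xy' , k' , p , q with K-unique Xy Xy' k k'
      ... | refl = w , Xw , inj₁ refl , q , p

    -- The index `A` collects the vertices already passed, whose cells `simple⇒factorizable` has
    -- already matched.
    data Simple (A : VSet) : Fin n → Fin n → Set₁ where
      stop : ∀ {u} → ¬ A u → X u → Simple A u u
      _∷_  : ∀ {u w y} → ¬ A u × Arc u w → Simple (λ a → A a ⊎ a ≡ u) w y → Simple A u y

    simple-start : ∀ {A u y} → Simple A u y → ¬ A u
    simple-start (stop ¬a _)    = ¬a
    simple-start ((¬a , _) ∷ _) = ¬a

    simple-end : ∀ {A u y} → Simple A u y → ¬ A y × X y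
    simple-end (stop ¬a x) = ¬a , x
    simple-end (_ ∷ p)     = let ¬a , x = simple-end p in ¬a ∘ inj₁ , x

    simple-mono : ∀ {A B u y} → B ⊆ A → Simple A u y → Simple B u y
    simple-mono f (stop ¬a x)    = stop (¬a ∘ f) x
    simple-mono f ((¬a , e) ∷ p) = (¬a ∘ f , e) ∷ simple-mono (λ { (inj₁ b) → inj₁ (f b) ; (inj₂ eq) → inj₂ eq }) p

    -- Loop erasure: a path meeting `u` is cut down to its part from `u` on.
    simple-avoid : ∀ {A w y} u → Simple A w y → Simple (λ a → A a ⊎ a ≡ u) w y ⊎ Simple A u y
    simple-avoid {w = w} u (stop ¬a x) with w ≟ u
    ... | yes refl = inj₂ (stop ¬a x)
    ... | no  w≢u  = inj₁ (stop [ ¬a , w≢u ]′ x)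
    simple-avoid {w = w} u ((¬a , e) ∷ p) with w ≟ u | simple-avoid u p
    ... | yes refl | _      = inj₂ ((¬a , e) ∷ p)
    ... | no  w≢u  | inj₁ q = inj₁ (([ ¬a , w≢u ]′ , e) ∷ simple-mono
          (λ { (inj₁ (inj₁ a)) → inj₁ (inj₁ a) ; (inj₁ (inj₂ eq)) → inj₂ eq ; (inj₂ eq) → inj₁ (inj₂ eq) }) q)
    ... | no  _    | inj₂ q = inj₂ (simple-mono inj₁ q)

    path⇒simple : ∀ {u y} → X u → Path u y → Simple (λ _ → ⊥) u y
    path⇒simple Xu ε = stop (λ ()) Xu
    path⇒simple {u} Xu (a@(_ , Xw , _) ◅ p) with simple-avoid u (path⇒simple Xw p)
    ... | inj₁ q = ((λ ()) , a) ∷ q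
    ... | inj₂ q = q

    Outside : VSet → VSet
    Outside A w = ∀ x → A x → ¬ Cell x w

    outside-closed : ∀ {A} → A ⊆ X → ∀ {w} → Outside A w → Outside A (m w)
    outside-closed A⊆X o x a c = o x a (subst (Cell _) (m-involutive _) (cell-closed (A⊆X a) c))

    K⊆outside : ∀ {A u w} → A ⊆ X → X u → ¬ A u → K u w → Outside A w
    K⊆outside {A} A⊆X Xu ¬a k x a c = ¬a (subst A (cell-unique (A⊆X a) Xu c (inj₂ k)) a)

    outside-extend : ∀ {A u w} → Outside A w → w ≢ u → ¬ K u w → Outside (λ a → A a ⊎ a ≡ u) w
    outside-extend o w≢u ¬k x (inj₁ a)    c = o x a c
    outside-extend o w≢u ¬k x (inj₂ refl) c = [ w≢u , ¬k ]′ c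

    -- Along x ⟶ x' ⟶ … ⟶ y match each K x to the next vertex of X, using
    -- that the components are factor-critical.
    simple⇒factorizable : ∀ {A u y v} → A ⊆ X → Simple A u y → K y v → Factorizable E (Outside A ∖ u ∖ v)
    simple⇒factorizable {A} {u} {.u} {v} A⊆X (stop ¬a Xu) k = factorizable-resp
      (λ { (inj₁ (k' , w≢v)) → (K⊆outside A⊆X Xu ¬a k' , λ { refl → K∩X k' Xu }) , w≢v
         ; (inj₂ o) → ((λ x a → o x (inj₁ a)) , λ { refl → o u (inj₂ refl) (inj₁ refl) })
                      , λ { refl → o u (inj₂ refl) (inj₂ k) } })
      (λ {w} ((o , w≢u) , w≢v) → split w o w≢u w≢v)
      (factorizable-∪ (∖? (K? u) v) (λ (k' , _) o → o u (inj₂ refl) (inj₂ k'))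
        (factor-critical Xu k)
        (m , pm-on (outside-closed λ { (inj₁ a) → A⊆X a ; (inj₂ refl) → Xu })))
      where
      split : ∀ w → Outside A w → w ≢ u → w ≢ v → ((K u ∖ v) ∪ Outside (λ a → A a ⊎ a ≡ u)) w
      split w o w≢u w≢v with K? u w
      ... | yes k' = inj₁ (k' , w≢v)
      ... | no ¬k' = inj₂ (outside-extend o w≢u ¬k')
    simple⇒factorizable {A} {u} {y} {v} A⊆X (_∷_ {w = u₁} (¬a , Xu , Xu₁ , z , kz , e) p) k = factorizable-resp
      (λ { (inj₁ (k' , _)) → in-K k'
         ; (inj₂ (inj₁ (inj₁ refl))) → in-K kz
         ; (inj₂ (inj₁ (inj₂ refl))) →
             ((λ x a → λ { (inj₁ refl) → simple-start p (inj₁ a) ; (inj₂ k') → K∩X k' Xu₁ })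
              , λ { refl → simple-start p (inj₂ refl) }) , λ { refl → K∩X k Xu₁ }
         ; (inj₂ (inj₂ ((o , _) , w≢v))) →
             ((λ x a → o x (inj₁ a)) , λ { refl → o u (inj₂ refl) (inj₁ refl) }) , w≢v })
      (λ {w} ((o , w≢u) , w≢v) → split w o w≢u w≢v)
      (factorizable-∪ (∖? (K? u) z)
        (λ { (_ , w≢z) (inj₁ (inj₁ refl)) → w≢z refl
           ; (k' , _) (inj₁ (inj₂ refl)) → K∩X k' Xu₁
           ; (k' , _) (inj₂ ((o , _) , _)) → o u (inj₂ refl) (inj₂ k') })
        -- `K u` is matched except for `z`, the edge of the arc matches `z` to the next vertex `u₁`,
        -- and the rest of the path is treated without the cell of `u`.
        (factor-critical Xu kz)
        (factorizable-∪ (λ w → (w ≟ z) ⊎-dec (w ≟ u₁))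
          (λ { (inj₁ refl) ((o , _) , _) → o u (inj₂ refl) (inj₂ kz)
             ; (inj₂ refl) ((_ , w≢u₁) , _) → w≢u₁ refl })
          (factorizable-edge e)
          (simple⇒factorizable (λ { (inj₁ a) → A⊆X a ; (inj₂ refl) → Xu }) p k)))
      where
      A⁺ : VSet
      A⁺ a = A a ⊎ a ≡ u
      y≢u : y ≢ u
      y≢u refl = proj₁ (simple-end p) (inj₂ refl)
      in-K : ∀ {w} → K u w → (Outside A ∖ u ∖ v) w
      in-K k' = (K⊆outside A⊆X Xu ¬a k' , λ { refl → K∩X k' Xu })
              , λ { refl → y≢u (K-unique (proj₂ (simple-end p)) Xu k k') }
      split : ∀ w → Outside A w → w ≢ u → w ≢ v →
              ((K u ∖ z) ∪ ((λ w → w ≡ z ⊎ w ≡ u₁) ∪ (Outside A⁺ ∖ u₁ ∖ v))) w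
      split w o w≢u w≢v with K? u w | w ≟ z | w ≟ u₁
      ... | yes _  | yes q | _     = inj₂ (inj₁ (inj₁ q))
      ... | yes k' | no q  | _     = inj₁ (k' , q)
      ... | no _   | _     | yes q = inj₂ (inj₁ (inj₂ q))
      ... | no ¬k' | _     | no q  = inj₂ (inj₂ ((outside-extend o w≢u ¬k' , q) , w≢v))

    abstract
      path⇒factorizable : ∀ {u y v} → X u → Path u y → K y v → Factorizable E (λ w → w ≢ u × w ≢ v)
      path⇒factorizable Xu p k = factorizable-resp
        (λ ((_ , w≢u) , w≢v) → w≢u , w≢v) (λ (w≢u , w≢v) → ((λ _ ()) , w≢u) , w≢v)
        (simple⇒factorizable (λ ()) (path⇒simple Xu p) k)

    -- Strongly connected arcs join vertices of one factor-component: zy is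
    -- allowed, and if z were not in the factor-component H of m x then K x ∩ H
    -- would be odd by m and even by a perfect matching through zy.
    arc-back⇒areach : ∀ {x y} → Arc x y → Path y x → AReach x y
    arc-back⇒areach {x} {y} (Xx , Xy , z , k , e) p
      -- As `z` lies in `K x`, the path from `y` back to `x` gives a perfect matching of
      -- `G - y - z`; with the edge `zy` it becomes `m₂`.
      with factorizable-edge e | path⇒factorizable Xy p k
    ... | f , pf | g , pg with pm-∪ (λ w → (w ≟ z) ⊎-dec (w ≟ y))
                                 (λ { (inj₁ refl) (_ , q) → q refl ; (inj₂ refl) (q , _) → q refl }) pf pg
    ... | m₂ , p₂ , agree = areach-trans (allowed⇒areach (pm⇒allowed pm x))
                              (areach-trans (decidable-stable (areach? (m x) z) z∈H)
                                (allowed⇒areach (allowed-sym (subst (Allowed y) m₂y (pm⇒allowed pm₂ y)))))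
      where
      fy : f y ≡ z
      fy with pf y (inj₂ refl)
      ... | inj₁ q , _          = q
      ... | inj₂ q , _ , nf , _ = contradiction q nf
      m₂y : m₂ y ≡ z
      m₂y = trans (agree (inj₂ refl)) fy
      cover : ∀ w → (w ≡ z ⊎ w ≡ y) ⊎ (w ≢ y × w ≢ z)
      cover w with w ≟ z | w ≟ y
      ... | yes q | _     = inj₁ (inj₁ q)
      ... | no _  | yes q = inj₁ (inj₂ q)
      ... | no a  | no b  = inj₂ (b , a)
      pm₂ : IsPerfectMatchingOn E All m₂
      pm₂ v _ = let _ , rest = p₂ v (cover v) in tt , rest
      module PM₂ = PerfectMatching pm₂
      P : VSet
      P w = K x w × AReach (m x) w
      z∈H : ¬ ¬ AReach (m x) z
      z∈H ¬z with sized {P = P} (λ w → K? x w ×-dec areach? (m x) w)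
      ... | l , hP = even-odd (involution⇒even hP by-m₂) (involution⇒odd hP (m∈K Xx , here) by-m)
        where
        by-m : Involution (P ∖ m x) m
        by-m = record
          { closed = λ {v} ((k , r) , v≢mx) →
              (K-closed Xx k v≢mx , areach-trans r (allowed⇒areach (pm⇒allowed pm v)))
              , λ eq → K∩X k (subst X (sym (m-injective eq)) Xx)
          ; involutive = λ _ → m-involutive _
          ; no-fixed = λ _ → m-no-fixed _ }
        -- If `m₂ v` were in `X`, then `m₂ v` and `y` would have their `m₂`-partners `v` and `z`
        -- both in `K x`. So `v` is `z`, which was assumed not to lie in the factor-component.
        m₂-closed : ∀ {v} → P v → K x (m₂ v)
        m₂-closed {v} (k' , r) = reach-snoc k' (PM₂.m-edge v) λ Xm₂v → ¬z (subst (AReach (m x))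
          (trans (sym (PM₂.m-involutive v)) (trans (cong m₂ (Certified.separate (certified pm₂) Xm₂v Xy
            (subst (λ a → Reach E (∁ X) a (m₂ y)) (sym (PM₂.m-involutive v))
              (subst (Reach E (∁ X) v) (sym m₂y) (reach-trans (reach-sym k') k))))) m₂y)) r)
        by-m₂ : Involution P m₂
        by-m₂ = record
          { closed = λ {v} Pv → m₂-closed Pv , areach-trans (proj₂ Pv) (allowed⇒areach (pm⇒allowed pm₂ v))
          ; involutive = λ _ → PM₂.m-involutive _
          ; no-fixed = λ _ → PM₂.m-no-fixed _ }

    strong⇒areach : ∀ {x y} → Path x y → Path y x → AReach x y
    strong⇒areach ε       _ = here
    strong⇒areach (a ◅ p) q = areach-trans (arc-back⇒areach a (p ◅◅ q)) (strong⇒areach p (q ◅◅ (a ◅ ε)))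

    abstract
      areach⇒cell : ∀ {x v} → X x → AReach x v → ∃[ y ] (X y × Cell y v × Path x y × Path y x)
      areach⇒cell {x} Xx = areach-invariant
        {Q = λ v → ∃[ y ] (X y × Cell y v × Path x y × Path y x)}
        (λ (y , Xy , c , p , q) a → let y' , Xy' , c' , p' , q' = cell-allowed Xy c a
                                    in y' , Xy' , c' , p ◅◅ p' , q' ◅◅ q)
        (x , Xx , inj₁ refl , ε , ε)

    areach⇒path : ∀ {x y} → X x → X y → AReach x y → Path x y
    areach⇒path Xx Xy r with areach⇒cell Xx r
    ... | y' , Xy' , c , p , _ with cell-unique Xy' Xy c (inj₁ refl)
    ... | refl = p

    -- A vertex outside `X` in the factor-component of `u` lies in `K y` for some `y` reached from
    -- `u`, and rotating along that path matches all but `u` and `v`.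
    ∼⇒X : ∀ {u v} → X u → u ∼ v → X v
    ∼⇒X Xu (r , ¬F) with areach⇒cell Xu r
    ... | y , Xy , inj₁ refl , _     = Xy
    ... | y , Xy , inj₂ k    , p , _ = contradiction (path⇒factorizable Xu p k) ¬F

    -- With `Q = X` the Hall count shows that a perfect matching of `G - u - v`, which must match
    -- all odd components, would also cover `u`.
    X⇒∼ : ∀ {u v} → X u → X v → AReach u v → u ∼ v
    X⇒∼ {u} {v} Xu Xv r = r , λ (_ , pN) → proj₁ (proj₁ (hall X? id (λ _ _ _ Xy → Xy) pN
      (λ _ k → (λ { refl → K∩X k Xu }) , λ { refl → K∩X k Xv }) Xu)) refl

-- The part of D_X above one factor-component

module Decompositions (G : Graph) where
  open GraphNotions G
  open Counting G
  open Matchings G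
  open Barriers G
  open FactorComponents G

  module Decomposition {X : VSet} {m : Fin n → Fin n} (pm : IsPerfectMatchingOn E All m) (X? : Decidable X)
      (certified : ∀ {m'} → IsPerfectMatchingOn E All m' → Certified m' X)
      (factor-critical : ∀ {x v} → X x → Reach E (∁ X) (m x) v → Factorizable E (Reach E (∁ X) (m x) ∖ v)) where

    open Cells pm X? certified factor-critical
    open PerfectMatching pm

    module _ {u : Fin n} (Xu : X u) where

      H : VSet
      H = AReach u

      H? : Decidable H
      H? = areach? u

      Part : VSet
      Part v = ∃[ y ] (X y × H y × K y v)

      part? : Decidable Part
      part? v = any? λ y → X? y ×-dec H? y ×-dec K? y v

      -- This is `Part` together with `X ∩ H`; it serves as the separating set witnessing `H ⊴ H'`
      -- for every factor-component `H'` that meets `Part`.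
      Hull : VSet
      Hull v = ∃[ y ] (X y × H y × Cell y v)

      hull? : Decidable Hull
      hull? v = any? λ y → X? y ×-dec H? y ×-dec cell? y v

      hull-closed : ∀ {v w} → Hull v → AReach v w → Hull w
      hull-closed = areach-invariant {Q = Hull} λ (y , Xy , Hy , c) a →
        let y' , Xy' , c' , p , q = cell-allowed Xy c a
        in y' , Xy' , areach-trans Hy (strong⇒areach p q) , c'

      H⊆hull : H ⊆ Hull
      H⊆hull = hull-closed (u , Xu , here , inj₁ refl)

      ∉H-closed : ∀ {v w} → ¬ H v → AReach v w → ¬ H w
      ∉H-closed ¬h r h = ¬h (areach-trans h (areach-sym r))

      areach-m : ∀ v → AReach v (m v)
      areach-m v = allowed⇒areach (pm⇒allowed pm v)

      separating-hull : Separating Hull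
      separating-hull H₀ (r , H₀⊆ , ⊆H₀) with hull? r
      ... | yes h = inj₁ λ h₀ → hull-closed h (H₀⊆ h₀)
      ... | no ¬h = inj₂ λ w h₀ h → ¬h (hull-closed h (areach-sym (H₀⊆ h₀)))

      -- Switching m along an alternating path from v ∈ K y to its first vertex
      -- p next to H leaves only v and p uncovered.
      expose : ∀ {y v} → X y → H y → K y v → ¬ H v →
               ∃[ p ] ((Hull p × ¬ H p) × p ≢ v × (∃[ h ] (H h × E p h)) ×
                       Factorizable E ((λ w → Hull w × ¬ H w) ∖ v ∖ p))
      expose {y} {v} Xy Hy k ¬Hv = conclude (restrict (∖? (K? y) v) T? (proj₂ (factor-critical Xy k)))
        where
        N₀ : Fin n → Fin n
        N₀ = proj₁ (factor-critical Xy k)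
        T : VSet
        T w = K y w × ¬ H w
        T? : Decidable T
        T? w = K? y w ×-dec ¬? (H? w)
        Hmy : H (m y)
        Hmy = areach-trans Hy (areach-m y)
        T-pm : IsPerfectMatchingOn E T m
        T-pm = pm-on λ {w} (k , ¬h) → K-closed Xy k (λ { refl → ¬h Hmy }) , ∉H-closed ¬h (areach-m w)
        Rest : VSet
        Rest w = (Hull w × ¬ H w) × ¬ K y w
        Rest-pm : IsPerfectMatchingOn E Rest m
        Rest-pm = pm-on λ {w} ((h , ¬Hw) , ¬k) →
          (hull-closed h (areach-m w) , ∉H-closed ¬Hw (areach-m w)) ,
          λ kmw → ¬k (subst (K y) (m-involutive w) (K-closed Xy kmw
            λ eq → ¬Hw (subst H (sym (m-injective eq)) Hy)))
        T⊆ : ∀ {w} → T w → Hull w × ¬ H w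
        T⊆ (k , ¬h) = (y , Xy , Hy , inj₂ k) , ¬h
        conclude : Σ[ N ∈ (Fin n → Fin n) ] (Matching T N ×
                     (∀ {w} → (K y ∖ v) w → T w → T (N₀ w) → N w ≡ N₀ w) ×
                     (∀ {w} → ¬ ((K y ∖ v) w × T w × T (N₀ w)) → N w ≡ w)) →
                   ∃[ p ] ((Hull p × ¬ H p) × p ≢ v × (∃[ h ] (H h × E p h)) ×
                       Factorizable E ((λ w → Hull w × ¬ H w) ∖ v ∖ p))
        conclude (N , MN , kept , dropped) = finish
          (alternate _ (proj₂ (sized T?)) T-pm MN (k , ¬Hv) (dropped λ ((_ , v≢v) , _) → v≢v refl))
          where
          finish : ∃[ p ] (T p × p ≢ v × N p ≡ p × Factorizable E (T ∖ v ∖ p)) →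
                   ∃[ p ] ((Hull p × ¬ H p) × p ≢ v × (∃[ h ] (H h × E p h)) ×
                       Factorizable E ((λ w → Hull w × ¬ H w) ∖ v ∖ p))
          finish (p , Tp@(kp , _) , p≢v , Np , F) with proj₂ (factor-critical Xy k) p (kp , p≢v)
          ... | (kN₀p , _) , e , nf , _ = p , T⊆ Tp , p≢v ,
            -- The cut-down matching `N` misses `p`, so the edge of `N₀` at `p` was dropped and its
            -- other end is in `H`.
            (N₀ p , decidable-stable (H? (N₀ p))
              (λ ¬h → nf (trans (sym (kept (kp , p≢v) Tp (kN₀p , ¬h))) Np)) , e) ,
            factorizable-resp
              (λ { (inj₁ ((t , w≢v) , w≢p)) → (T⊆ t , w≢v) , w≢p
                 ; (inj₂ (h , ¬k)) → (h , λ { refl → ¬k k }) , λ { refl → ¬k kp } })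
              (λ {w} ((h , w≢v) , w≢p) → split w h w≢v w≢p)
              (factorizable-∪ (∖? (∖? T? v) p) (λ (((k' , _) , _) , _) (_ , ¬k) → ¬k k') F (m , Rest-pm))
            where
            split : ∀ w → Hull w × ¬ H w → w ≢ v → w ≢ p → ((T ∖ v ∖ p) ∪ Rest) w
            split w (h , ¬Hw) w≢v w≢p with K? y w
            ... | yes k' = inj₁ (((k' , ¬Hw) , w≢v) , w≢p)
            ... | no ¬k' = inj₂ ((h , ¬Hw) , ¬k')

      -- Without the contracted vertex, `m` is a perfect matching. Without some `v` outside `H`, the
      -- vertex `p` found by `expose` is matched to the contracted vertex.
      hull-critical : FactorCritical (ContrE E H) (ContrV E Hull H)
      hull-critical nothing _ = lift , lift-pm
        where
        lift : Maybe (Fin n) → Maybe (Fin n)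
        lift nothing  = nothing
        lift (just w) = just (m w)
        lift-pm : IsPerfectMatchingOn (ContrE E H) (_without_ (ContrE E H) (ContrV E Hull H) nothing) lift
        lift-pm nothing  (_ , n≢n) = contradiction refl n≢n
        lift-pm (just w) ((h , ¬Hw) , _) =
          ((hull-closed h (areach-m w) , ∉H-closed ¬Hw (areach-m w)) , λ ()) , m-edge w
          , (λ eq → m-no-fixed w (just-injective eq)) , cong just (m-involutive w)
      hull-critical (just v) ((y , Xy , Hy , inj₁ refl) , ¬Hv) = contradiction Hy ¬Hv
      hull-critical (just v) ((y , Xy , Hy , inj₂ k) , ¬Hv) with expose Xy Hy k ¬Hv
      ... | p , Hp , p≢v , (h , Hh , e) , g , pg = lift , lift-pm
        where
        lift : Maybe (Fin n) → Maybe (Fin n)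
        lift nothing = just p
        lift (just w) with w ≟ p
        ... | yes _ = nothing
        ... | no _  = just (g w)
        lift-p : lift (just p) ≡ nothing
        lift-p with p ≟ p
        ... | yes _  = refl
        ... | no p≢p = contradiction refl p≢p
        lift-g : ∀ {w} → w ≢ p → lift (just w) ≡ just (g w)
        lift-g {w} w≢p with w ≟ p
        ... | yes w≡p = contradiction w≡p w≢p
        ... | no _    = refl
        lift-pm : IsPerfectMatchingOn (ContrE E H) (_without_ (ContrE E H) (ContrV E Hull H) (just v)) lift
        lift-pm nothing _ = (Hp , λ eq → p≢v (just-injective eq)) , (h , Hh , E-sym e) , (λ ()) , lift-p
        lift-pm (just w) (Hw , w≢v) with w ≟ p
        ... | yes refl = (tt , λ ()) , (h , Hh , e) , (λ ()) , refl
        ... | no w≢p with pg w ((Hw , λ { refl → w≢v refl }) , w≢p)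
        ... | ((c , gw≢v) , gw≢p) , e' , nf , i =
          (c , λ eq → gw≢v (just-injective eq)) , e' , (λ eq → nf (just-injective eq))
          , trans (lift-g gw≢p) (cong just i)

      part⇒Ustar : ∀ {v} → Part v → Ustar H v
      part⇒Ustar {v} (y , Xy , Hy , k) = AReach v , (v , id , id) ,
        (Hull , separating-hull , H⊆hull , hull-closed (y , Xy , Hy , inj₂ k) , hull-critical) , here

      S : VSet
      S = u ∼_

      S⇒X : ∀ {v} → S v → X v
      S⇒X = ∼⇒X Xu

      -- K y is connected and contains the vertex m y of H, so the component of
      -- G[U(H)] containing v is adjacent to some vertex of H outside X.
      part⇒∉UstarS : ∀ {v} → Part v → ¬ UstarS H S v
      part⇒∉UstarS (_ , _ , _ , k) (inj₂ s) = K∩X k (S⇒X s)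
      part⇒∉UstarS {v} (y , Xy , Hy , k) (inj₁ (H' , (_ , _ , _ , c , Uc , ΓK⊆S , H'⊆K) , H'v)) =
        walk (H'⊆K H'v) k (reach-trans (reach-sym k) (m∈K Xy))
        where
        walk : ∀ {w} → Reach E (Uminus H) c w → K y w → Reach E (∁ X) w (m y) → ⊥
        walk r kw (here _) = proj₂ (reach-end r) (areach-trans Hy (areach-m y))
        walk r kw (step {w = w'} _ e p) with H? w'
        ... | yes Hw' = reach-start p (S⇒X (ΓK⊆S w' Hw' (λ r' → proj₂ (reach-end r') Hw') (_ , r , e)))
        ... | no ¬Hw' = walk (reach-snoc r e (part⇒Ustar (y , Xy , Hy , kw') , ¬Hw')) kw' p
          where kw' = reach-snoc kw e (reach-start p)

      -- If a ∈ U(H) then G − (H − p) − a has a perfect matching for some p ∈ H,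
      -- so the vertices reachable from a cannot avoid H by Hall's condition.
      X∩Ustar⇒path : ∀ {a} → X a → Ustar H a → ¬ H a → ¬ (∀ {s} → X s → H s → ¬ Path a s)
      X∩Ustar⇒path {a} Xa (H' , _ , (Z , sep , H⊆Z , H'⊆Z , crit) , H'a) ¬Ha none =
        build (crit (just a) (H'⊆Z H'a , ¬Ha))
        where
        Z? : Decidable Z
        Z? w with sep (AReach w) (w , id , id)
        ... | inj₁ sub  = yes (sub here)
        ... | inj₂ disj = no (disj w here)
        Z-closed : ∀ {v w} → Z v → AReach v w → Z w
        Z-closed {v} z r with sep (AReach v) (v , id , id)
        ... | inj₁ sub  = sub r
        ... | inj₂ disj = ⊥-elim (disj v here z)
        build : ¬ Factorizable (ContrE E H) (_without_ (ContrE E H) (ContrV E Z H) (just a))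
        build (m' , pm') with m' nothing in m'n | pm' nothing (tt , λ ())
        ... | nothing | _ , () , _
        ... | just q  | ((Zq , ¬Hq) , q≢a) , (p , Hp , e) , _ , m'q = not-a (proj₁ a-covered)
          where
          -- The contracted vertex is expanded to the single vertex `p` of `H`, a neighbour of its
          -- partner `q`.
          W : VSet
          W w = ((Z w × ¬ H w) × w ≢ a) ⊎ w ≡ p
          p≢q : p ≢ q
          p≢q refl = ¬Hq Hp
          -- The value `p` at `nothing` makes the expanded matching send `q` back to `p`.
          default : Maybe (Fin n) → Fin n
          default nothing  = p
          default (just w) = w
          N : Fin n → Fin n
          N w with w ≟ p
          ... | yes _ = q
          ... | no _  = default (m' (just w))
          N-p : N p ≡ q
          N-p with p ≟ p
          ... | yes _  = refl
          ... | no p≢p = contradiction refl p≢p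
          N-default : ∀ {w} → ¬ H w → N w ≡ default (m' (just w))
          N-default {w} ¬Hw with w ≟ p
          ... | yes refl = contradiction Hp ¬Hw
          ... | no _     = refl
          N-pm : IsPerfectMatchingOn E W N
          N-pm w (inj₂ refl) rewrite N-p = inj₁ ((Zq , ¬Hq) , λ { refl → q≢a refl }) , e , p≢q ∘ sym ,
            trans (N-default ¬Hq) (cong default m'q)
          N-pm w (inj₁ ((Zw , ¬Hw) , w≢a)) rewrite N-default ¬Hw
            with m' (just w) | pm' (just w) ((Zw , ¬Hw) , λ eq → w≢a (just-injective eq))
          ... | nothing | _ , _ , _ , i with trans (sym m'n) i
          ... | refl = inj₂ refl , E-sym e , (λ { refl → ¬Hw Hp }) , N-p
          N-pm w (inj₁ ((Zw , ¬Hw) , w≢a))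
              | just w' | ((Zw' , ¬Hw') , w'≢a) , e' , nf , i =
            inj₁ ((Zw' , ¬Hw') , λ { refl → w'≢a refl }) , e' , (λ { refl → nf refl }) ,
            trans (N-default ¬Hw') (cong default i)
          Outer : VSet
          Outer w = ¬ Z w
          Outer-pm : IsPerfectMatchingOn E Outer m
          Outer-pm = pm-on λ {w} ¬z z → ¬z (Z-closed z (areach-sym (areach-m w)))
          W? : Decidable W
          W? w = ((Z? w ×-dec ¬? (H? w)) ×-dec ¬? (w ≟ a)) ⊎-dec (w ≟ p)
          all-pm = pm-∪ W? (λ { (inj₁ ((z , _) , _)) ¬z → ¬z z ; (inj₂ refl) ¬z → ¬z (H⊆Z Hp) }) N-pm Outer-pm
          -- A vertex of `H` in `K x` would force `x ∈ H`, against the assumption that no path from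
          -- `a` reaches `X ∩ H`. So these components are fully matched and Hall demands that `a` be
          -- covered too.
          K⊆ : ∀ {x} → X x × Path a x → K x ⊆ W ∪ Outer
          K⊆ {x} (Xx , path) {w} k with Z? w
          ... | no ¬z = inj₂ ¬z
          ... | yes z = inj₁ (inj₁ ((z , not-H) , λ { refl → K∩X k Xa }))
            where
            not-H : ¬ H w
            not-H Hw with H⊆hull Hw
            ... | y , Xy , Hy , c with cell-unique Xy Xx c (inj₂ k)
            ... | refl = none Xy Hy path
          a-covered : (W ∪ Outer) a × ∃[ x ] ((X x × Path a x) × K x (proj₁ all-pm a))
          a-covered = hall (λ x → X? x ×-dec path? a x) proj₁
            (λ (Xr , path) k e Xy → Xy , path ◅◅ ((Xr , Xy , _ , k , e) ◅ ε))
            (proj₁ (proj₂ all-pm)) K⊆ (Xa , ε)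
          not-a : ¬ (W ∪ Outer) a
          not-a (inj₁ (inj₁ (_ , a≢a))) = a≢a refl
          not-a (inj₁ (inj₂ refl))      = ¬Ha Hp
          not-a (inj₂ ¬z)               = ¬z (H'⊆Z H'a)

      -- Outside `X`, the neighbour `a` would belong to the component `K y` of `b`. Inside `X`,
      -- there is an arc from `y` to `a`, and a path leads from `a` back to `X ∩ H` and on to `y`,
      -- so strong connectivity puts `a` into `H`.
      entry-to-part : ∀ {a b} → ¬ Part a → Part b → E a b → Ustar H a → ¬ H a → ⊥
      entry-to-part {a} ¬Pa (y , Xy , Hy , k) e Ua ¬Ha with X? a
      ... | no ¬Xa = ¬Pa (y , Xy , Hy , reach-snoc k (E-sym e) ¬Xa)
      ... | yes Xa = X∩Ustar⇒path Xa Ua ¬Ha λ {s} Xs Hs path →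
        ¬Ha (areach-trans Hy (strong⇒areach (arc ◅ ε)
          (path ◅◅ areach⇒path Xs Xy (areach-trans (areach-sym Hs) Hy))))
        where arc = Xy , Xa , _ , k , E-sym e

      -- Suppose `v` is in no part. Then `v ∉ H`, since `H` lies in `Part ∪ S`, and by
      -- `entry-to-part` the component of `v` in G[U(H)] neither enters `Part` nor touches it. Its
      -- neighbours in `H` are thus in `S`, which makes `v` an element of U(S).
      Ustar∖UstarS⇒part : ∀ {v} → Ustar H v → ¬ UstarS H S v → Part v
      Ustar∖UstarS⇒part {v} Uv@(H' , fc@(r , H'⊆ , ⊆H') , H⊴H' , H'v) ¬US =
        decidable-stable (part? v) λ ¬Pv → ¬US (inj₁ (in-US ¬Pv))
        where
        module _ (¬Pv : ¬ Part v) where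
          ¬Hv : ¬ H v
          ¬Hv Hv with H⊆hull Hv
          ... | y , Xy , Hy , inj₁ refl = ¬US (inj₂ (X⇒∼ Xu Xy Hv))
          ... | y , Xy , Hy , inj₂ k    = ¬Pv (y , Xy , Hy , k)
          H'-U : H' ⊆ Uminus H
          H'-U h' = (H' , fc , H⊴H' , h') ,
            λ Hw → ¬Hv (areach-trans Hw (areach-trans (areach-sym (H'⊆ h')) (H'⊆ H'v)))
          -- Allowed edges never leave `H'`, and `H'` lies in U(H), so all of `H'` is in one
          -- component.
          connect : ∀ {w w'} → H' w → AReach w w' → Reach E (Uminus H) w w'
          connect h' here = here (H'-U h')
          connect h' (step a p) = step (H'-U h') (proj₁ a)
            (connect (⊆H' (areach-trans (H'⊆ h') (allowed⇒areach a))) p)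
          outside-part : ∀ {w} → Reach E (Uminus H) v w → ¬ Part w
          outside-part r = reach-invariant {Q = λ w → ¬ Part w × Uminus H w}
            (λ (¬Pa , Ua , ¬Ha) e Ub → (λ Pb → entry-to-part ¬Pa Pb e Ua ¬Ha) , Ub) r (¬Pv , reach-start r)
            .proj₁
          ΓK⊆S : ∀ w → H w → ¬ Reach E (Uminus H) v w →
                 (∃[ k' ] (Reach E (Uminus H) v k' × E k' w)) → S w
          ΓK⊆S w Hw _ (k' , r , e) with H⊆hull Hw
          ... | y , Xy , Hy , inj₁ refl = X⇒∼ Xu Xy Hw
          ... | y , Xy , Hy , inj₂ k    = let Uk' , ¬Hk' = reach-end r in
            ⊥-elim (entry-to-part (outside-part r) (y , Xy , Hy , k) e Uk' ¬Hk')
          in-US : US H S v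
          in-US = H' , (fc , H⊴H' , (λ (H'⊆H , _) → ¬Hv (H'⊆H H'v)) , v , H'-U H'v , ΓK⊆S ,
                   λ h' → connect H'v (areach-trans (areach-sym (H'⊆ H'v)) (H'⊆ h'))) , H'v

    -- Choosing representatives and assembling the decomposition

    part-unique : ∀ {u u' v} (Xu : X u) (Xu' : X u') → Part Xu v → Part Xu' v → AReach u u'
    part-unique _ _ (y , Xy , r , k) (y' , Xy' , r' , k') with K-unique Xy Xy' k k'
    ... | refl = areach-trans r (areach-sym r')

    abstract
      -- Each factor-component meeting `X` is represented by its least vertex in `X`.
      representatives : Σ[ k ∈ ℕ ] Σ[ e ∈ (Fin k → Fin n) ] ((∀ i → X (e i)) ×
                          (∀ {i j} → AReach (e i) (e j) → i ≡ j) × (∀ {x} → X x → ∃[ i ] AReach (e i) x))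
      representatives = k , e , (λ i → proj₁ (minimal i)) ,
        (λ {i} {j} r → e-injective (Finₚ.≤-antisym
          (proj₂ (minimal i) (e j) (proj₁ (minimal j) , r))
          (proj₂ (minimal j) (e i) (proj₁ (minimal i) , areach-sym r)))) ,
        index
        where
        Minimal : VSet
        Minimal x = X x × (∀ w → X w × AReach x w → x ≤ᶠ w)
        minimals : ∃ (HasSize Minimal)
        minimals = sized λ x → X? x ×-dec all? λ w → (X? w ×-dec areach? x w) →-dec (x Finₚ.≤? w)
        k : ℕ
        k = proj₁ minimals
        e : Fin k → Fin n
        e = proj₁ (enumeration (proj₂ minimals))
        e-injective : Injective _≡_ _≡_ e
        e-injective = proj₁ (proj₂ (enumeration (proj₂ minimals)))
        minimal : ∀ i → Minimal (e i)
        minimal = proj₁ (proj₂ (proj₂ (enumeration (proj₂ minimals))))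
        e-onto : ∀ {x} → Minimal x → ∃[ i ] e i ≡ x
        e-onto = proj₂ (proj₂ (proj₂ (enumeration (proj₂ minimals))))
        index : ∀ {x} → X x → ∃[ i ] AReach (e i) x
        index {x} Xx =
          let w , (Xw , r) , min = least (λ w → X? w ×-dec areach? x w) (Xx , here)
              i , eq = e-onto (Xw , λ w' (Xw' , r') → min w' (Xw' , areach-trans r r'))
          in i , subst (λ a → AReach a x) (sym eq) (areach-sym r)

    decomposition : Σ[ k ∈ ℕ ] Σ[ S ∈ (Fin k → VSet) ] Σ[ H ∈ (Fin k → VSet) ]
      ((∀ i → InP (S i)) × (∀ i → IsFactorComponent (H i)) × (∀ i → S i ⊆ H i) ×
       (∀ i j → i ≢ j → Disjoint (S i) (S j)) × (X ≐ λ v → ∃[ i ] S i v) ×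
       (∀ i j → i ≢ j → Disjoint (λ v → Ustar (H i) v × ¬ UstarS (H i) (S i) v)
                                 (λ v → Ustar (H j) v × ¬ UstarS (H j) (S j) v)) ×
       (D X ≐ λ v → ∃[ i ] (Ustar (H i) v × ¬ UstarS (H i) (S i) v)))
    decomposition with representatives
    ... | k , e , Xe , e-unique , index =
      k , (λ i → e i ∼_) , (λ i → AReach (e i)) ,
      (λ i → e i , id , id) , (λ i → e i , id , id) , (λ _ → proj₁) ,
      (λ i j i≢j v (r , _) (r' , _) → i≢j (e-unique (areach-trans r (areach-sym r')))) ,
      ((λ Xv → let i , r = index Xv in i , X⇒∼ (Xe i) Xv r) , λ (i , s) → ∼⇒X (Xe i) s) ,
      -- A common vertex lies in a single `K y`, and this `y` belongs to both factor-components.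
      (λ i j i≢j v (U , ¬US) (U' , ¬US') → i≢j (e-unique (part-unique (Xe i) (Xe j)
        (Ustar∖UstarS⇒part (Xe i) U ¬US) (Ustar∖UstarS⇒part (Xe j) U' ¬US')))) ,
      (λ d → let x , Xx , r = odd-component⇒partner X? d
                 i , rx = index Xx
                 p = x , Xx , rx , reach-sym r
             in i , part⇒Ustar (Xe i) p , part⇒∉UstarS (Xe i) p) ,
      λ (i , U , ¬US) → let y , Xy , _ , ky = Ustar∖UstarS⇒part (Xe i) U ¬US in
        partner⇒odd-component X? (certified pm) Xy (reach-sym ky)

mainTheorem1 : (G : Graph) → let open GraphNotions G in
    (X : VSet) → GFactorizable → OddMaximalBarrier X →
    Σ[ k ∈ ℕ ] Σ[ S ∈ (Fin k → VSet) ] Σ[ H ∈ (Fin k → VSet) ]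
    ((∀ i → InP (S i))
    × (∀ i → IsFactorComponent (H i))
    × (∀ i → S i ⊆ H i)
    × (∀ i j → i ≢ j → Disjoint (S i) (S j))
    × (X ≐ ⋃ (Fin k) S)
    × (∀ i j → i ≢ j → Disjoint (λ v → v ∈ Ustar (H i) × v ∉ UstarS (H i) (S i))
    (λ v → v ∈ Ustar (H j) × v ∉ UstarS (H j) (S j)))
    × (D X ≐ ⋃ (Fin k) (λ i v → v ∈ Ustar (H i) × v ∉ UstarS (H i) (S i))))
mainTheorem1 G X (m , pm) omb@(bar , _) =
  Decompositions.Decomposition.decomposition G pm (sized⇒decidable (proj₂ (proj₂ (barrier-balanced bar))))
    (λ pm' → PerfectMatching.barrier⇒certified pm' bar) (odd-maximal⇒factor-critical omb)
  where
  open Counting G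
  open Barriers G
  open PerfectMatching pm
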